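{- Let $\big((d_1^+,\dots,d_n^+),(d_1^-,\dots,d_n^-)\big)$ be a directed degree sequence, and let $$m=\sum_{i=1}^n d_i^+\quad\text{and}\quad m^*=\sum_{i=1}^n\left[\min(d_i^+,n-d_i^+)+\min(d_i^-,n-d_i^-)\right].$$ Then for all pairs of realizations $\vec G_1,\vec G_2$ of this directed degree sequence, $$\mathbf{dist}_d(\vec G_1,\vec G_2)\le H'(\vec G_1,\vec G_2)\cdot\left(1-\frac1n\right)\le m^*\left(\frac12-\frac1{2n}\right)\le m\left(1-\frac1n\right).$$
   Context: Directed graphs are finite, without loops and without parallel edges (both $xy$ and $yx$ may be present), with labeled vertices $x_1,\dots,x_n$. The directed degree sequence of $\vec G$ is the pair of sequences of out-degrees $d_i^+$ and in-degrees $d_i^-$ of the vertices $x_i$; $\vec G$ is then called a realization of this pair. Swaps: (1) A $C_4$-swap: for four distinct vertices $x,y,z,t$ with $xy,zt$ directed edges and $xt,zy$ not directed edges, replace $xy,zt$ by $xt,zy$. (2) A triangular $C_6$-swap: for three distinct vertices $x,y,z$ such that $xy,yz,zx$ are directed edges and $yx,zy,xz$ are not, replace $xy,yz,zx$ by $yx,zy,xz$. Only these two types of swaps are allowed. A $C_4$-swap has weight $1$, a triangular $C_6$-swap has weight $2$. $\mathbf{dist}_d(\vec G_1,\vec G_2)$ is the minimum total weight of a swap sequence transforming $\vec G_1$ into $\vec G_2$. $H'(\vec G_1,\vec G_2)=|E(\vec G_1)\,\Delta\, E(\vec G_2)|/2$, where $\Delta$ is the symmetric difference of the sets of directed edges.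 -}

module Defs where

open import Algebra.Properties.Monoid.Sum using (sum)
open import Data.Bool.Base using (Bool; true; false; if_then_else_; _xor_)
open import Data.Fin.Base using (Fin)
open import Data.Integer.Base using (+_)
open import Data.List.Base using ([]; _∷_)
open import Data.List.Relation.Unary.Unique.Propositional using (Unique)
open import Data.Nat.Base using (ℕ; NonZero; _+_; _∸_; _⊓_; _≤_)
open import Data.Nat.Properties using (+-0-monoid)
open import Data.Product.Base using (_×_)
open import Data.Rational.Base using (ℚ; _/_)
open import Data.Vec.Functional using (updateAt)
open import Function.Base using (const)
open import Relation.Binary.PropositionalEquality.Core using (_≡_)

∑ : ∀ {n} → (Fin n → ℕ) → ℕ
∑ = sum +-0-monoid

count : ∀ {n} → (Fin n → Bool) → ℕ
count p = ∑ (λ i → if p i then 1 else 0)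

-- A set of ordered pairs of vertices: (i , j) belongs to E iff E i j ≡ true.
Edges : ℕ → Set
Edges n = Fin n → Fin n → Bool

record Digraph (n : ℕ) : Set where
  field
    edge     : Edges n
    loopless : ∀ i → edge i i ≡ false

open Digraph public

infix 4 _≐_

_≐_ : ∀ {n} → Edges n → Edges n → Set
E ≐ F = ∀ i j → E i j ≡ F i j

module _ {n : ℕ} where

  outDegree inDegree : Digraph n → Fin n → ℕ
  outDegree G i = count (λ j → edge G i j)
  inDegree  G i = count (λ j → edge G j i)

  Realizes : Digraph n → (d⁺ d⁻ : Fin n → ℕ) → Set
  Realizes G d⁺ d⁻ = (∀ i → outDegree G i ≡ d⁺ i) × (∀ i → inDegree G i ≡ d⁻ i)

  put : Bool → Fin n → Fin n → Edges n → Edges n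
  put b u v E = updateAt E u (λ row → updateAt row v (const b))

  insert delete : Fin n → Fin n → Edges n → Edges n
  insert = put true
  delete = put false

  data C₄-Swap (G H : Digraph n) : Set where
    c₄-swap : ∀ x y z t → Unique (x ∷ y ∷ z ∷ t ∷ []) →
      edge G x y ≡ true  → edge G z t ≡ true →
      edge G x t ≡ false → edge G z y ≡ false →
      edge H ≐ insert x t (insert z y (delete x y (delete z t (edge G)))) →
      C₄-Swap G H

  data C₆-Swap (G H : Digraph n) : Set where
    c₆-swap : ∀ x y z → Unique (x ∷ y ∷ z ∷ []) →
      edge G x y ≡ true  → edge G y z ≡ true  → edge G z x ≡ true →
      edge G y x ≡ false → edge G z y ≡ false → edge G x z ≡ false →
      edge H ≐ insert y x (insert z y (insert x z
                 (delete x y (delete y z (delete z x (edge G)))))) →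
      C₆-Swap G H

  -- Swap sequences, indexed by their total weight.
  data Swaps : Digraph n → Digraph n → ℕ → Set where
    done : ∀ {G H} → edge G ≐ edge H → Swaps G H 0
    c₄   : ∀ {G H K w} → C₄-Swap G H → Swaps H K w → Swaps G K (1 + w)
    c₆   : ∀ {G H K w} → C₆-Swap G H → Swaps H K w → Swaps G K (2 + w)

  -- The distance is a minimum, hence given as a relation; it asserts that
  -- some swap sequence exists, and it determines w uniquely.
  Dist : Digraph n → Digraph n → ℕ → Set
  Dist G H w = Swaps G H w × (∀ w′ → Swaps G H w′ → w ≤ w′)

  ∣_Δ_∣ : Digraph n → Digraph n → ℕ
  ∣ G Δ H ∣ = ∑ (λ i → count (λ j → edge G i j xor edge H i j))

  H′ : Digraph n → Digraph n → ℚ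
  H′ G H = + ∣ G Δ H ∣ / 2

  -- Degrees in a realization are less than n, so n ∸ d never truncates there.
  m⋆ : (d⁺ d⁻ : Fin n → ℕ) → ℕ
  m⋆ d⁺ d⁻ = ∑ (λ i → (d⁺ i ⊓ (n ∸ d⁺ i)) + (d⁻ i ⊓ (n ∸ d⁻ i)))

fromℕ : ℕ → ℚ
fromℕ k = + k / 1

1/ : (k : ℕ) → .{{NonZero k}} → ℚ
1/ k = + 1 / k

{-# OPTIONS --safe #-}

-- View a digraph as a bipartite graph between the out-copies and the in-copies of the vertices.
-- Direct the pairs in E(G₁) ∖ E(G₂) from out-copy to in-copy and those in E(G₂) ∖ E(G₁) backwards;
-- since the degrees agree, this is a balanced orientation of E(G₁) Δ E(G₂), so the latter contains
-- a cycle that alternates between the two graphs and repeats no vertex. Such a cycle has length 2ℓ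
-- with ℓ ≤ n, and swaps of total weight ℓ - 1 suffice to flip it: ℓ = 2 is a C₄-swap, ℓ = 3 with
-- all chords being loops is a triangular C₆-swap, and otherwise a chord that is not a loop cuts the
-- cycle into two shorter ones, which are flipped one after the other. Since ℓ - 1 ≤ ℓ (1 - 1/n),
-- flipping cycles until G₂ is reached gives the first inequality. The others bound each row and
-- column of the symmetric difference by twice min(d , n - d), and that minimum by d.
module Submission where

open import Defs
open import Data.Bool.Base using (Bool; true; false; not; if_then_else_; _xor_; _∧_)
import Data.Bool.Properties as 𝔹
open import Data.Bool.Solver using (module xor-∧-Solver)
open import Data.Fin.Base using (Fin; zero; suc; toℕ)
open import Data.Fin.Properties as Fin using (_≟_)
import Data.Integer.Base as ℤ
import Data.Integer.Properties as ℤ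
open import Data.Integer.Solver using () renaming (module +-*-Solver to ℤ-Solver)
open import Data.List.Base as List using (List; []; _∷_; foldr; applyUpTo)
open import Data.List.Membership.Propositional using (_∈_)
open import Data.List.Relation.Unary.All as All using (All; []; _∷_)
import Data.List.Relation.Unary.All.Properties as All
open import Data.List.Relation.Unary.AllPairs as AllPairs using (AllPairs; []; _∷_)
open import Data.List.Relation.Unary.Any using (here; there)
import Data.List.Relation.Unary.Unique.DecPropositional as DecUnique
open import Data.List.Relation.Unary.Unique.Propositional using (Unique)
import Data.List.Relation.Unary.Unique.Propositional.Properties as Unique
open import Data.Nat.Base using (ℕ; NonZero)
open import Data.Nat.Base as ℕ
  using (zero; suc; pred; _+_; _∸_; _⊓_; _<_; z≤n; s≤s; z<s)
open import Data.Nat.Induction using (<-rec)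
open import Data.Nat.Properties as ℕ using (m*n≢0)
open import Data.Nat.Solver using (module +-*-Solver)
open import Data.Product.Base
  using (_×_; _,_; proj₁; proj₂; ∃; ∃₂; Σ-syntax; ∃-syntax)
import Data.Rational.Base as ℚ
open import Data.Rational.Base using (1ℚ; ½; _*_; _-_; _≤_; toℚᵘ)
import Data.Rational.Properties as ℚ
open import Data.Rational.Unnormalised.Base as ℚᵘ using (mkℚᵘ; *≤*; *≡*)
import Data.Rational.Unnormalised.Properties as ℚᵘ
open import Data.Sum.Base using (_⊎_; inj₁; inj₂)
open import Data.Unit.Base using (⊤; tt)
open import Data.Vec.Functional.Properties using (updateAt-updates; updateAt-minimal)
open import Function.Base using (_∘_)
open import Relation.Binary.PropositionalEquality
  using (_≡_; _≢_; _≗_; refl; sym; trans; cong; cong₂; subst; subst₂; module ≡-Reasoning)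
open import Relation.Nullary.Decidable
  using (Dec; yes; no; does; dec-true; dec-false; map′; _×-dec_; _⊎-dec_)
open import Relation.Nullary.Negation using (¬_; contradiction)

open import Algebra.Properties.CommutativeMonoid.Sum ℕ.+-0-commutativeMonoid
  using (∑-comm; ∑-distrib-+)
import Algebra.Properties.CommutativeSemigroup ℕ.+-commutativeSemigroup as ℕ+
open import Algebra.Properties.Monoid.Sum ℕ.+-0-monoid using (sum-cong-≗)

AllPairs-++⁻ : {A : Set} {R : A → A → Set} → ∀ xs {ys} → AllPairs R (xs List.++ ys) →
               All (λ x → All (R x) ys) xs × AllPairs R ys
AllPairs-++⁻ []       rs       = [] , rs
AllPairs-++⁻ (x ∷ xs) (r ∷ rs) =
  let between , right = AllPairs-++⁻ xs rs in All.++⁻ʳ xs r ∷ between , right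

-- Edits of an edge set as symmetric differences.

Put : ℕ → Set
Put n = Bool × Fin n × Fin n

module _ {n : ℕ} where

  private variable
    a b c x y : Fin n

  infixl 6 _⊕_

  _⊕_ : Edges n → Edges n → Edges n
  (E ⊕ F) i j = E i j xor F i j

  ∅ : Edges n
  ∅ _ _ = false

  δ : Fin n → Fin n → Edges n
  δ u v i j = does (u ≟ i) ∧ does (v ≟ j)

  δ-hit : ∀ u v → δ u v u v ≡ true
  δ-hit u v = cong₂ _∧_ (dec-true (u ≟ u) refl) (dec-true (v ≟ v) refl)

  δ-missˡ : ∀ u v i j → u ≢ i → δ u v i j ≡ false
  δ-missˡ u v i j u≢i = cong (_∧ does (v ≟ j)) (dec-false (u ≟ i) u≢i)

  δ-missʳ : ∀ u v i j → v ≢ j → δ u v i j ≡ false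
  δ-missʳ u v i j v≢j =
    trans (cong (does (u ≟ i) ∧_) (dec-false (v ≟ j) v≢j)) (𝔹.∧-zeroʳ (does (u ≟ i)))

  put-if : ∀ b u v (E : Edges n) i j → put b u v E i j ≡ (if δ u v i j then b else E i j)
  put-if b u v E i j with u ≟ i
  ... | no u≢i = cong (λ row → row j) (updateAt-minimal i u E (u≢i ∘ sym))
  ... | yes refl with v ≟ j
  ...   | yes refl = trans (cong (λ row → row v) (updateAt-updates u E)) (updateAt-updates v (E u))
  ...   | no v≢j   = trans (cong (λ row → row j) (updateAt-updates u E))
                           (updateAt-minimal j v (E u) (v≢j ∘ sym))

  put-cong : ∀ b u v {E F : Edges n} → E ≐ F → put b u v E ≐ put b u v F
  put-cong b u v {E} {F} E≐F i j = begin
    put b u v E i j                    ≡⟨ put-if b u v E i j ⟩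
    (if δ u v i j then b else E i j)   ≡⟨ cong (if δ u v i j then b else_) (E≐F i j) ⟩
    (if δ u v i j then b else F i j)   ≡⟨ put-if b u v F i j ⟨
    put b u v F i j                    ∎
    where open ≡-Reasoning

  put-flips : ∀ b u v (E : Edges n) → E u v ≡ not b → put b u v E ≐ δ u v ⊕ E
  put-flips b u v E Euv i j rewrite put-if b u v E i j with u ≟ i | v ≟ j
  ... | no _     | _        = refl
  ... | yes refl | no _     = refl
  ... | yes refl | yes refl rewrite Euv = sym (𝔹.not-involutive b)

  -- On a concrete list this unfolds to the nested `insert`s and `delete`s that define a swap; the
  -- head of the list is applied last.
  puts : List (Put n) → Edges n → Edges n
  puts ps E = foldr (λ (b , u , v) → put b u v) E ps

  toggled : List (Put n) → Edges n
  toggled = foldr (λ (b , u , v) → δ u v ⊕_) ∅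

  Apart : Put n → Put n → Set
  Apart (_ , u , v) (_ , u′ , v′) = (u′ ≢ u) ⊎ (v′ ≢ v)

  Flips : Edges n → Put n → Set
  Flips E (b , u , v) = E u v ≡ not b

  toggled-apart : ∀ {b u v} ps → All (Apart (b , u , v)) ps → toggled ps u v ≡ false
  toggled-apart []       []            = refl
  toggled-apart {b} {u} {v} ((_ , u′ , v′) ∷ ps) (inj₁ h ∷ hs) =
    cong₂ _xor_ (δ-missˡ u′ v′ u v h) (toggled-apart {b} ps hs)
  toggled-apart {b} {u} {v} ((_ , u′ , v′) ∷ ps) (inj₂ h ∷ hs) =
    cong₂ _xor_ (δ-missʳ u′ v′ u v h) (toggled-apart {b} ps hs)

  -- The edits in the tail act on other positions, so the entry at the head still has its original
  -- value `not b`, and overwriting it by `b` is a toggle. Toggles commute, so the order of the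
  -- edits ceases to matter.
  puts-toggle : ∀ (E : Edges n) ps → AllPairs Apart ps → All (Flips E) ps →
                puts ps E ≐ E ⊕ toggled ps
  puts-toggle E []                 _        _        i j = sym (𝔹.xor-identityʳ (E i j))
  puts-toggle E ((b , u , v) ∷ ps) (h ∷ hs) (f ∷ fs) i j = begin
    put b u v (puts ps E) i j                    ≡⟨ put-flips b u v (puts ps E) flips i j ⟩
    δ u v i j xor puts ps E i j                  ≡⟨ cong (δ u v i j xor_) (IH i j) ⟩
    δ u v i j xor (E i j xor toggled ps i j)     ≡⟨ solve 3 (λ d e t → d :+ (e :+ t) := e :+ (d :+ t))
                                                      refl (δ u v i j) (E i j) (toggled ps i j) ⟩
    E i j xor (δ u v i j xor toggled ps i j)     ∎
    where
    open ≡-Reasoning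
    open xor-∧-Solver
    IH = puts-toggle E ps hs fs
    flips : puts ps E u v ≡ not b
    flips = begin
      puts ps E u v                ≡⟨ IH u v ⟩
      E u v xor toggled ps u v     ≡⟨ cong (E u v xor_) (toggled-apart {b} ps h) ⟩
      E u v xor false              ≡⟨ 𝔹.xor-identityʳ (E u v) ⟩
      E u v                        ≡⟨ f ⟩
      not b                        ∎

  -- Walks between out- and in-copies, and the pairs they toggle.

  -- In the bipartite graph of out- and in-copies of the vertices, Walk b a runs from the
  -- out-copy of a to the out-copy of b; step v {y} passes through the in-copy of v to the
  -- out-copy of y, so from x it uses the pairs (x , v) and (y , v).
  data Walk (b : Fin n) : Fin n → Set where
    []   : Walk b b
    step : ∀ {x} (v : Fin n) {y} → Walk b y → Walk b x

  infixr 5 _++_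

  _++_ : Walk b a → Walk c b → Walk c a
  []       ++ Q = Q
  step v P ++ Q = step v (P ++ Q)

  length : Walk b a → ℕ
  length []         = 0
  length (step _ P) = suc (length P)

  columns rows : Walk b a → List (Fin n)
  columns []             = []
  columns (step v P)     = v ∷ columns P
  rows    []             = []
  rows    (step _ {y} P) = y ∷ rows P

  toggles : Walk b a → Edges n
  toggles         []             = ∅
  toggles {a = x} (step v {y} P) = δ x v ⊕ (δ y v ⊕ toggles P)

  StepPredicate : Set₁
  StepPredicate = Fin n → Fin n → Fin n → Set

  Along : StepPredicate → Walk b a → Set
  Along         S []             = ⊤
  Along {a = x} S (step v {y} P) = S x v y × Along S P

  -- The inequalities keep the flipped graph loopless and supply distinctness conditions of the
  -- swaps. All values are taken in the one edge set `E`, before anything is toggled.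
  Alternating : Edges n → Walk b a → Set
  Alternating E = Along (λ x v y → E x v ≡ true × E y v ≡ false × x ≢ v × y ≢ v)

  length-++ : ∀ (P : Walk b a) (Q : Walk c b) → length (P ++ Q) ≡ length P + length Q
  length-++ []         Q = refl
  length-++ (step _ P) Q = cong suc (length-++ P Q)

  columns-++ : ∀ (P : Walk b a) (Q : Walk c b) →
               columns (P ++ Q) ≡ columns P List.++ columns Q
  columns-++ []         Q = refl
  columns-++ (step v P) Q = cong (v ∷_) (columns-++ P Q)

  toggles-++ : ∀ (P : Walk b a) (Q : Walk c b) → toggles (P ++ Q) ≐ toggles P ⊕ toggles Q
  toggles-++         []             Q i j = refl
  toggles-++ {a = x} (step v {y} P) Q i j rewrite toggles-++ P Q i j =
    solve 4 (λ p q r s → p :+ (q :+ (r :+ s)) := (p :+ (q :+ r)) :+ s) refl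
      (δ x v i j) (δ y v i j) (toggles P i j) (toggles Q i j)
    where open xor-∧-Solver

  Along-++⁺ : ∀ {S : StepPredicate} (P : Walk b a) {Q : Walk c b} →
              Along S P → Along S Q → Along S (P ++ Q)
  Along-++⁺ []         _        q = q
  Along-++⁺ (step _ P) (s , ss) q = s , Along-++⁺ P ss q

  Along-++⁻ : ∀ {S : StepPredicate} (P : Walk b a) {Q : Walk c b} →
              Along S (P ++ Q) → Along S P × Along S Q
  Along-++⁻ []         q        = tt , q
  Along-++⁻ (step _ P) (s , ss) = let p , q = Along-++⁻ P ss in (s , p) , q

  Along-map : ∀ {S S′ : StepPredicate} (P : Walk b a) →
              (∀ {x v y} → v ∈ columns P → S x v y → S′ x v y) →
              Along S P → Along S′ P
  Along-map []         f _        = tt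
  Along-map (step _ P) f (s , ss) = f (here refl) s , Along-map P (f ∘ there) ss

  toggles-column : ∀ (P : Walk b a) i {j} → All (j ≢_) (columns P) → toggles P i j ≡ false
  toggles-column []         i []       = refl
  toggles-column {a = x} (step v {y} P) i {j} (h ∷ hs) =
    cong₂ _xor_ (δ-missʳ x v i j (h ∘ sym))
      (cong₂ _xor_ (δ-missʳ y v i j (h ∘ sym)) (toggles-column P i hs))

  toggles-loopless : ∀ {E : Edges n} (P : Walk b a) → Alternating E P → ∀ i → toggles P i i ≡ false
  toggles-loopless         []             _                          i = refl
  toggles-loopless {a = x} (step v {y} P) ((_ , _ , x≢v , y≢v) , as) i =
    cong₂ _xor_ (δ-diagonal x v x≢v) (cong₂ _xor_ (δ-diagonal y v y≢v) (toggles-loopless P as i))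
    where
    δ-diagonal : ∀ u v → u ≢ v → δ u v i i ≡ false
    δ-diagonal u v u≢v with u ≟ i
    ... | no _     = refl
    ... | yes refl = dec-false (v ≟ u) (u≢v ∘ sym)

  flipAlong : ∀ (G : Digraph n) (P : Walk b a) → Alternating (edge G) P → Digraph n
  flipAlong G P alt .edge       = edge G ⊕ toggles P
  flipAlong G P alt .loopless i = cong₂ _xor_ (loopless G i) (toggles-loopless P alt i)

  -- Only entries in the columns of `P` are inspected, so alternation survives toggling a walk whose
  -- columns are disjoint from those of `P`.
  Alternating-cong : ∀ {E F : Edges n} (P : Walk b a) → (∀ i {j} → j ∈ columns P → F i j ≡ E i j) →
                     Alternating E P → Alternating F P
  Alternating-cong P agree = Along-map P λ {x} {v} {y} v∈P (e , f , h) →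
    trans (agree x v∈P) e , trans (agree y v∈P) f , h

  -- Flipping an alternating cycle by swaps.

  -- The swaps for W are put in front of a given sequence, which makes it unnecessary to
  -- concatenate sequences.
  Solvable : Walk a a → Set
  Solvable W = ∀ {G H K w} → Alternating (edge G) W → edge H ≐ edge G ⊕ toggles W →
               Swaps H K w → Swaps G K (pred (length W) + w)

  ⊕-missed : ∀ (E T : Edges n) i j → T i j ≡ false → (E ⊕ T) i j ≡ E i j
  ⊕-missed E T i j eq = trans (cong (E i j xor_) eq) (𝔹.xor-identityʳ (E i j))

  ⊕-hit : ∀ (E T : Edges n) i j → T i j ≡ true → (E ⊕ T) i j ≡ not (E i j)
  ⊕-hit E T i j eq = trans (cong (E i j xor_) eq) (𝔹.xor-comm (E i j) true)

  differentRows : ∀ (E : Edges n) {v} → E x v ≡ true → E y v ≡ false → x ≢ y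
  differentRows E e f refl = contradiction (trans (sym e) f) λ ()

  -- The chord (a , v) cuts the cycle into two. If it is a non-edge, the part before it is
  -- flipped first, which makes the chord an edge; otherwise the part after it goes first.
  split : ∀ (P : Walk x a) v (Q : Walk a y) → a ≢ x → a ≢ y → a ≢ v →
          Unique (columns (P ++ step v Q)) →
          Solvable (P ++ step v []) → Solvable (step v Q) → Solvable (P ++ step v Q)
  split {x} {a} {y} P v Q a≢x a≢y a≢v uniq solveA solveB {G} {H} {K} {w} alt H≐ rest
    with Along-++⁻ P {step v Q} alt
  ... | altP , (Gxv , Gyv , x≢v , y≢v) , altQ = byChord (edge G a v) refl
    where
    open ≡-Reasoning
    open xor-∧-Solver
    E = edge G
    A : Walk a a
    A = P ++ step v []
    B : Walk a a
    B = step v Q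

    uniq′ : Unique (columns P List.++ v ∷ columns Q)
    uniq′ = subst Unique (columns-++ P (step v Q)) uniq

    P#v∷Q : All (λ j → All (j ≢_) (v ∷ columns Q)) (columns P)
    P#v∷Q = proj₁ (AllPairs-++⁻ (columns P) uniq′)

    v#P : All (v ≢_) (columns P)
    v#P = All.map (λ h → All.head h ∘ sym) P#v∷Q

    v#Q : All (v ≢_) (columns Q)
    v#Q = AllPairs.head (proj₂ (AllPairs-++⁻ (columns P) uniq′))

    -- `A` and `B` have lengths `length P + 1` and `length Q + 1`, the whole cycle
    -- `length P + length Q + 1`. The chord is counted twice and the predecessors add up exactly, so
    -- cutting costs nothing.
    weight : pred (length A) + (length Q + w) ≡ pred (length (P ++ step v Q)) + w
    weight = begin
      pred (length A) + (length Q + w)    ≡⟨ cong (λ l → pred l + (length Q + w)) ∣A∣ ⟩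
      length P + (length Q + w)           ≡⟨ ℕ.+-assoc (length P) (length Q) w ⟨
      length P + length Q + w             ≡⟨ cong (λ l → pred l + w) ∣W∣ ⟨
      pred (length (P ++ step v Q)) + w   ∎
      where
      ∣A∣ : length A ≡ suc (length P)
      ∣A∣ = trans (length-++ P (step v [])) (ℕ.+-comm (length P) 1)
      ∣W∣ : length (P ++ step v Q) ≡ suc (length P + length Q)
      ∣W∣ = trans (length-++ P (step v Q)) (ℕ.+-suc (length P) (length Q))

    swapWeights : length Q + (pred (length A) + w) ≡ pred (length A) + (length Q + w)
    swapWeights = ℕ+.x∙yz≈y∙xz (length Q) (pred (length A)) w

    byChord : ∀ b → E a v ≡ b → Swaps G K (pred (length (P ++ step v Q)) + w)
    byChord false Gav = subst (Swaps G K) weight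
      (solveA {G} {M} altA (λ _ _ → refl) (solveB {M} {H} altB H≐M⊕B rest))
      where
      altA : Alternating E A
      altA = Along-++⁺ P altP ((Gxv , Gav , x≢v , a≢v) , tt)
      M = flipAlong G A altA
      -- In column `v`, `A` toggles only rows `x` and `a`. Hence flipping `A` makes the chord an
      -- edge and leaves the non-edge `(y , v)` alone, which is how `B` alternates afterwards.
      A-x : ∀ i → i ≢ x → toggles A i v ≡ δ a v i v
      A-x i i≢x = begin
        toggles A i v                                  ≡⟨ toggles-++ P (step v []) i v ⟩
        toggles P i v xor (δ x v i v xor (δ a v i v xor false))
          ≡⟨ cong₂ _xor_ (toggles-column P i v#P)
               (cong₂ _xor_ (δ-missˡ x v i v (i≢x ∘ sym)) (𝔹.xor-identityʳ (δ a v i v))) ⟩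
        δ a v i v                                      ∎
      A-Q : ∀ i {j} → j ∈ columns Q → toggles A i j ≡ false
      A-Q i {j} j∈Q = begin
        toggles A i j                                  ≡⟨ toggles-++ P (step v []) i j ⟩
        toggles P i j xor (δ x v i j xor (δ a v i j xor false))
          ≡⟨ cong₂ _xor_ (toggles-column P i (All.map (λ h → All.lookup h (there j∈Q) ∘ sym) P#v∷Q))
              (cong₂ _xor_ (δ-missʳ x v i j v≢j) (cong (_xor false) (δ-missʳ a v i j v≢j))) ⟩
        false ∎
        where v≢j = All.lookup v#Q j∈Q
      altB : Alternating (edge M) B
      altB = ( trans (⊕-hit E (toggles A) a v (trans (A-x a a≢x) (δ-hit a v))) (cong not Gav)
             , trans (⊕-missed E (toggles A) y v
                 (trans (A-x y (differentRows E Gxv Gyv ∘ sym)) (δ-missˡ a v y v a≢y))) Gyv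
             , a≢v , y≢v)
           , Alternating-cong Q (λ i {j} j∈Q → ⊕-missed E (toggles A) i j (A-Q i j∈Q)) altQ
      H≐M⊕B : edge H ≐ edge M ⊕ toggles B
      H≐M⊕B i j = begin
        edge H i j ≡⟨ H≐ i j ⟩
        E i j xor toggles (P ++ step v Q) i j ≡⟨ cong (E i j xor_) (toggles-++ P (step v Q) i j) ⟩
        E i j xor (toggles P i j xor (δ x v i j xor (δ y v i j xor toggles Q i j)))
          ≡⟨ regroup (E i j) (toggles P i j) (δ x v i j) (δ y v i j) (toggles Q i j) (δ a v i j) ⟩
        (E i j xor (toggles P i j xor (δ x v i j xor (δ a v i j xor false)))) xor toggles B i j
          ≡⟨ cong (λ t → (E i j xor t) xor toggles B i j) (toggles-++ P (step v []) i j) ⟨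
        edge M i j xor toggles B i j ∎
        where
        -- The chord `d` is toggled once in `A` and once in `B`, and cancels.
        regroup : ∀ e p s t q d → e xor (p xor (s xor (t xor q))) ≡
                    (e xor (p xor (s xor (d xor false)))) xor (d xor (t xor q))
        regroup = solve 6 (λ e p s t q d → e :+ (p :+ (s :+ (t :+ q))) :=
          (e :+ (p :+ (s :+ (d :+ con false)))) :+ (d :+ (t :+ q))) refl
    byChord true Gav = subst (Swaps G K) (trans swapWeights weight)
      (solveB {G} {M} altB (λ _ _ → refl) (solveA {M} {H} altA H≐M⊕A rest))
      where
      altB : Alternating E B
      altB = (Gav , Gyv , a≢v , y≢v) , altQ
      M = flipAlong G B altB
      B-y : ∀ i → i ≢ y → toggles B i v ≡ δ a v i v
      B-y i i≢y = trans (cong (δ a v i v xor_)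
          (cong₂ _xor_ (δ-missˡ y v i v (i≢y ∘ sym)) (toggles-column Q i v#Q)))
        (𝔹.xor-identityʳ (δ a v i v))
      altA : Alternating (edge M) A
      altA = Along-++⁺ P
        (Alternating-cong P (λ i {j} j∈P →
          ⊕-missed E (toggles B) i j (toggles-column B i (All.lookup P#v∷Q j∈P))) altP)
        (( trans (⊕-missed E (toggles B) x v
             (trans (B-y x (differentRows E Gxv Gyv)) (δ-missˡ a v x v a≢x))) Gxv
         , trans (⊕-hit E (toggles B) a v (trans (B-y a a≢y) (δ-hit a v))) (cong not Gav)
         , x≢v , a≢v) , tt)
      H≐M⊕A : edge H ≐ edge M ⊕ toggles A
      H≐M⊕A i j = begin
        edge H i j ≡⟨ H≐ i j ⟩
        E i j xor toggles (P ++ step v Q) i j ≡⟨ cong (E i j xor_) (toggles-++ P (step v Q) i j) ⟩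
        E i j xor (toggles P i j xor (δ x v i j xor (δ y v i j xor toggles Q i j)))
          ≡⟨ regroup (E i j) (toggles P i j) (δ x v i j) (δ y v i j) (toggles Q i j) (δ a v i j) ⟩
        edge M i j xor (toggles P i j xor (δ x v i j xor (δ a v i j xor false)))
          ≡⟨ cong (edge M i j xor_) (toggles-++ P (step v []) i j) ⟨
        edge M i j xor toggles A i j ∎
        where
        regroup : ∀ e p s t q d → e xor (p xor (s xor (t xor q))) ≡
                    (e xor (d xor (t xor q))) xor (p xor (s xor (d xor false)))
        regroup = solve 6 (λ e p s t q d → e :+ (p :+ (s :+ (t :+ q))) :=
          (e :+ (d :+ (t :+ q))) :+ (p :+ (s :+ (d :+ con false)))) refl

  -- The rows `a` and `b` differ because column `v₁` has different values there; rows differ from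
  -- columns because no pair is a loop. Only `v₁ ≢ v₂` has to be assumed for the four vertices to be
  -- distinct.
  solve-4 : ∀ v₁ v₂ → v₁ ≢ v₂ → Solvable {a} (step v₁ {b} (step v₂ []))
  solve-4 {a} {b} v₁ v₂ v₁≢v₂ {G} {H}
    ((a-v₁ , b-v₁ , a≢v₁ , b≢v₁) , (b-v₂ , a-v₂ , b≢v₂ , a≢v₂) , _) H≐ rest =
    c₄ (c₄-swap a v₁ b v₂
          ((a≢v₁ ∷ a≢b ∷ a≢v₂ ∷ []) ∷ (b≢v₁ ∘ sym ∷ v₁≢v₂ ∷ []) ∷ (b≢v₂ ∷ []) ∷ [] ∷ [])
          a-v₁ b-v₂ a-v₂ b-v₁ puts≐)
       rest
    where
    a≢b : a ≢ b
    a≢b = differentRows (edge G) a-v₁ b-v₁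
    ps : List (Put n)
    ps = (true , a , v₂) ∷ (true , b , v₁) ∷ (false , a , v₁) ∷ (false , b , v₂) ∷ []
    apart : AllPairs Apart ps
    apart = (inj₁ (a≢b ∘ sym) ∷ inj₂ v₁≢v₂ ∷ inj₁ (a≢b ∘ sym) ∷ [])
          ∷ (inj₁ a≢b ∷ inj₂ (v₁≢v₂ ∘ sym) ∷ [])
          ∷ (inj₁ (a≢b ∘ sym) ∷ []) ∷ [] ∷ []
    puts≐ : edge H ≐ puts ps (edge G)
    puts≐ i j = trans (H≐ i j) (trans
      (solve 5 (λ e p q r s → e :+ (p :+ (q :+ (r :+ (s :+ con false)))) :=
                              e :+ (s :+ (q :+ (p :+ (r :+ con false))))) refl
        (edge G i j) (δ a v₁ i j) (δ b v₁ i j) (δ b v₂ i j) (δ a v₂ i j))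
      (sym (puts-toggle (edge G) ps apart (a-v₂ ∷ b-v₁ ∷ a-v₁ ∷ b-v₂ ∷ []) i j)))
      where open xor-∧-Solver

  -- With each column equal to the opposite row, the six pairs are the two orientations of one
  -- triangle: `p r`, `r q`, `q p` are present and their reversals absent.
  solve-triangle : ∀ a b c → Solvable {a} (step c {b} (step a {c} (step b [])))
  solve-triangle p q r {G} {H}
    ((pr , qr , p≢r , q≢r) , (qp , rp , q≢p , _) , (rq , pq , _) , _) H≐ rest =
    c₆ (c₆-swap p r q
          ((p≢r ∷ (q≢p ∘ sym) ∷ []) ∷ ((q≢r ∘ sym) ∷ []) ∷ [] ∷ [])
          pr rq qp rp qr pq puts≐)
       rest
    where
    ps : List (Put n)
    ps = (true , r , p) ∷ (true , q , r) ∷ (true , p , q) ∷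
         (false , p , r) ∷ (false , r , q) ∷ (false , q , p) ∷ []
    apart : AllPairs Apart ps
    apart = (inj₁ q≢r ∷ inj₁ p≢r ∷ inj₁ p≢r ∷ inj₂ q≢p ∷ inj₁ q≢r ∷ [])
          ∷ (inj₁ (q≢p ∘ sym) ∷ inj₁ (q≢p ∘ sym) ∷ inj₁ (q≢r ∘ sym) ∷ inj₂ p≢r ∷ [])
          ∷ (inj₂ (q≢r ∘ sym) ∷ inj₁ (p≢r ∘ sym) ∷ inj₁ q≢p ∷ [])
          ∷ (inj₁ (p≢r ∘ sym) ∷ inj₁ q≢p ∷ [])
          ∷ (inj₁ q≢r ∷ []) ∷ [] ∷ []
    puts≐ : edge H ≐ puts ps (edge G)
    puts≐ i j = trans (H≐ i j) (trans
      (solve 7 (λ e pr qr qp rp rq pq →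
                  e :+ (pr :+ (qr :+ (qp :+ (rp :+ (rq :+ (pq :+ con false)))))) :=
                  e :+ (rp :+ (qr :+ (pq :+ (pr :+ (rq :+ (qp :+ con false)))))))
        refl (edge G i j) (δ p r i j) (δ q r i j) (δ q p i j) (δ r p i j) (δ r q i j) (δ p q i j))
      (sym (puts-toggle (edge G) ps apart (rp ∷ qr ∷ pq ∷ pr ∷ rq ∷ qp ∷ []) i j)))
      where open xor-∧-Solver

  -- The chord `(a , v₂)` joins opposite corners of the hexagon, so both halves are 4-cycles.
  solve-6-split : ∀ v₁ v₂ v₃ → a ≢ b → a ≢ c → v₁ ≢ v₂ → v₁ ≢ v₃ → v₂ ≢ v₃ → a ≢ v₂ →
                  Solvable {a} (step v₁ {b} (step v₂ {c} (step v₃ [])))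
  solve-6-split v₁ v₂ v₃ a≢b a≢c v₁≢v₂ v₁≢v₃ v₂≢v₃ a≢v₂ =
    split (step v₁ []) v₂ (step v₃ []) a≢b a≢c a≢v₂
      ((v₁≢v₂ ∷ v₁≢v₃ ∷ []) ∷ (v₂≢v₃ ∷ []) ∷ [] ∷ [])
      (solve-4 v₁ v₂ v₁≢v₂) (solve-4 v₂ v₃ v₂≢v₃)

  -- Moving the base point only permutes the toggles. It brings the other two long chords into the
  -- position that `solve-6-split` expects.
  solve-rotated : ∀ v₁ v₂ v₃ → Solvable {b} (step v₂ {c} (step v₃ {a} (step v₁ []))) →
                  Solvable {a} (step v₁ {b} (step v₂ {c} (step v₃ [])))
  solve-rotated {b} {c} {a} v₁ v₂ v₃ solvable {G} (s₁ , s₂ , s₃ , _) H≐ = solvable (s₂ , s₃ , s₁ , _)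
    λ i j → trans (H≐ i j) (cong (edge G i j xor_)
      (solve 6 (λ p q r s t u → p :+ (q :+ (r :+ (s :+ (t :+ (u :+ con false))))) :=
                                r :+ (s :+ (t :+ (u :+ (p :+ (q :+ con false)))))) refl
        (δ a v₁ i j) (δ b v₁ i j) (δ b v₂ i j) (δ c v₂ i j) (δ c v₃ i j) (δ a v₃ i j)))
    where open xor-∧-Solver

  -- The long chords are `(a , v₂)`, `(b , v₃)` and `(c , v₁)`. One that is not a loop is rotated to
  -- the base point and used for cutting; if all are loops, the hexagon is a triangle.
  solve-6 : ∀ v₁ v₂ v₃ → a ≢ b → a ≢ c → b ≢ c → v₁ ≢ v₂ → v₁ ≢ v₃ → v₂ ≢ v₃ →
            Solvable {a} (step v₁ {b} (step v₂ {c} (step v₃ [])))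
  solve-6 {a} {b} {c} v₁ v₂ v₃ a≢b a≢c b≢c v₁≢v₂ v₁≢v₃ v₂≢v₃ with a ≟ v₂ | b ≟ v₃ | c ≟ v₁
  ... | no a≢v₂  | _        | _        = solve-6-split v₁ v₂ v₃ a≢b a≢c v₁≢v₂ v₁≢v₃ v₂≢v₃ a≢v₂
  ... | yes _    | no b≢v₃  | _        = solve-rotated v₁ v₂ v₃
    (solve-6-split v₂ v₃ v₁ b≢c (a≢b ∘ sym) v₂≢v₃ (v₁≢v₂ ∘ sym) (v₁≢v₃ ∘ sym) b≢v₃)
  ... | yes _    | yes _    | no c≢v₁  = solve-rotated v₁ v₂ v₃ (solve-rotated v₂ v₃ v₁
    (solve-6-split v₃ v₁ v₂ (a≢c ∘ sym) (b≢c ∘ sym) (v₁≢v₃ ∘ sym) (v₂≢v₃ ∘ sym) v₁≢v₂ c≢v₁))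
  ... | yes refl | yes refl | yes refl = solve-triangle a b c

  end∈rows : ∀ v (Q : Walk a y) → a ∈ rows {a = x} (step v Q)
  end∈rows         v []                 = here refl
  end∈rows {y = y} v (step {x = y} v′ Q) = there (end∈rows {x = y} v′ Q)

  -- `rows` lists the end point of a nonempty walk last, so in a closed walk uniqueness of the rows
  -- separates the base point from the intermediate rows.
  end≢ : ∀ v (Q : Walk b y) → All (a ≢_) (y ∷ rows Q) → b ≢ a
  end≢ {y = y} v Q a#Q = All.lookup a#Q (end∈rows {x = y} v Q) ∘ sym

  -- If the chord (a , v₂) is a loop, then a = v₂ ≢ v₃, so the chord (a , v₃) is not.
  solve-cycle : ∀ v (Q : Walk a y) → Unique (columns {a = a} (step v Q)) →
                Unique (rows {a = a} (step v Q)) → Solvable {a} (step v Q)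
  solve-cycle v [] _ _ ((av , ¬av , _) , _) = contradiction (trans (sym av) ¬av) λ ()
  solve-cycle v₁ (step v₂ []) ((v₁≢v₂ ∷ []) ∷ _) _ = solve-4 v₁ v₂ v₁≢v₂
  solve-cycle v₁ (step v₂ (step v₃ []))
    ((v₁≢v₂ ∷ v₁≢v₃ ∷ []) ∷ (v₂≢v₃ ∷ []) ∷ _) ((b≢c ∷ b≢a ∷ []) ∷ (c≢a ∷ []) ∷ _) =
    solve-6 v₁ v₂ v₃ (b≢a ∘ sym) (c≢a ∘ sym) b≢c v₁≢v₂ v₁≢v₃ v₂≢v₃
  solve-cycle {a} v₁ (step v₂ Q₃@(step v₃ Q₄@(step v₄ Q₅)))
    cs@((v₁≢v₂ ∷ v₁≢v₃ ∷ _) ∷ cs₂@((v₂≢v₃ ∷ _) ∷ cs₃))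
    ((b≢c ∷ b#) ∷ rs₂@(c# ∷ rs₃@(d# ∷ _)))
    -- What remains after a cut is a tail of the walk, re-based at `a`. Its columns and rows are
    -- tails of the given lists, so their uniqueness is inherited.
    with a ≟ v₂ | solve-cycle {a} v₂ Q₃ cs₂ rs₂ | solve-cycle {a} v₃ Q₄ cs₃ rs₃
  ... | no a≢v₂  | solve₂ | _ = split (step v₁ []) v₂ Q₃ (end≢ v₃ Q₄ b#) (end≢ v₃ Q₄ c#) a≢v₂ cs
        (solve-4 v₁ v₂ v₁≢v₂) solve₂
  ... | yes refl | _ | solve₃ = split (step v₁ (step v₂ [])) v₃ Q₄
        (end≢ v₃ Q₄ c#) (end≢ v₄ Q₅ d#) v₂≢v₃ cs
        (solve-6 v₁ v₂ v₃ (end≢ v₃ Q₄ b#) (end≢ v₃ Q₄ c#) b≢c v₁≢v₂ v₁≢v₃ v₂≢v₃) solve₃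

-- Effect of toggling on edge counts and degrees.

[_] : Bool → ℕ
[ b ] = if b then 1 else 0

count-cong : ∀ {n} {p q : Fin n → Bool} → p ≗ q → count p ≡ count q
count-cong p≗q = sum-cong-≗ (cong [_] ∘ p≗q)

∑-increment : ∀ {n} {f g : Fin n → ℕ} k → f k ≡ suc (g k) → (∀ i → k ≢ i → f i ≡ g i) →
              ∑ f ≡ suc (∑ g)
∑-increment zero    fk≡ f≗g = cong₂ _+_ fk≡ (sum-cong-≗ λ i → f≗g (suc i) λ ())
∑-increment {f = f} {g} (suc k) fk≡ f≗g = trans
  (cong₂ _+_ (f≗g zero λ ()) (∑-increment k fk≡ λ i k≢i → f≗g (suc i) (k≢i ∘ Fin.suc-injective)))
  (ℕ.+-suc (g zero) _)

module _ {n : ℕ} where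

  private variable
    a b x y : Fin n

  count-flip-true : ∀ (p : Fin n → Bool) k → p k ≡ true →
                    suc (count (λ j → p j xor does (k ≟ j))) ≡ count p
  count-flip-true p k pk = sym (∑-increment k
    (trans (cong [_] pk) (cong (suc ∘ [_]) (sym (cong₂ _xor_ pk (dec-true (k ≟ k) refl)))))
    λ j k≢j → cong [_] (sym (trans (cong (p j xor_) (dec-false (k ≟ j) k≢j)) (𝔹.xor-identityʳ (p j)))))

  count-flip-false : ∀ (p : Fin n → Bool) k → p k ≡ false →
                     count (λ j → p j xor does (k ≟ j)) ≡ suc (count p)
  count-flip-false p k pk = ∑-increment k
    (trans (cong [_] (cong₂ _xor_ pk (dec-true (k ≟ k) refl))) (cong (suc ∘ [_]) (sym pk)))
    λ j k≢j → cong [_] (trans (cong (p j xor_) (dec-false (k ≟ j) k≢j)) (𝔹.xor-identityʳ (p j)))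

  ι : Fin n → Fin n → ℕ
  ι u i = [ does (u ≟ i) ]

  -- Adding `ι u i` to the smaller side treats the affected row and all others in one equation
  -- without truncated subtraction; the later degree equations keep this form.
  row-flip-true : ∀ (E : Edges n) u v i → E u v ≡ true →
                  count ((E ⊕ δ u v) i) + ι u i ≡ count (E i)
  row-flip-true E u v i Euv with u ≟ i
  ... | yes refl = trans (ℕ.+-comm _ 1) (count-flip-true (E u) v Euv)
  ... | no _     = trans (ℕ.+-identityʳ _) (count-cong λ j → 𝔹.xor-identityʳ (E i j))

  row-flip-false : ∀ (E : Edges n) u v i → E u v ≡ false →
                   count ((E ⊕ δ u v) i) ≡ count (E i) + ι u i
  row-flip-false E u v i Euv with u ≟ i
  ... | yes refl = trans (count-flip-false (E u) v Euv) (ℕ.+-comm 1 _)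
  ... | no _     = trans (count-cong λ j → 𝔹.xor-identityʳ (E i j)) (sym (ℕ.+-identityʳ _))

  infix 8 _ᵀ

  _ᵀ : Edges n → Edges n
  (E ᵀ) i j = E j i

  -- Transposing `δ u v` gives `δ v u`, which reduces in-degrees to the lemmas on rows.
  column-flip : ∀ (E : Edges n) u v j →
                count (((E ⊕ δ u v) ᵀ) j) ≡ count ((E ᵀ ⊕ δ v u) j)
  column-flip E u v j = count-cong λ i → cong (E i j xor_) (𝔹.∧-comm (does (u ≟ i)) (does (v ≟ j)))

  edgeCount : Edges n → ℕ
  edgeCount E = ∑ λ i → count (E i)

  edgeCount-flip : ∀ (E : Edges n) u v → E u v ≡ true →
                   suc (edgeCount (E ⊕ δ u v)) ≡ edgeCount E
  edgeCount-flip E u v Euv = sym (∑-increment u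
    (trans (sym (row-flip-true E u v u Euv)) (trans (ℕ.+-comm _ (ι u u))
       (cong (λ b → [ b ] + count ((E ⊕ δ u v) u)) (dec-true (u ≟ u) refl))))
    λ i u≢i → trans (sym (row-flip-true E u v i Euv)) (trans
       (cong (λ b → count ((E ⊕ δ u v) i) + [ b ]) (dec-false (u ≟ i) u≢i)) (ℕ.+-identityʳ _)))

  ⊕-step : ∀ (E : Edges n) x v y (P : Walk b y) →
           E ⊕ toggles {a = x} (step v P) ≐ E ⊕ δ x v ⊕ δ y v ⊕ toggles P
  ⊕-step E x v y P i j = solve 4 (λ e p q t → e :+ (p :+ (q :+ t)) := e :+ p :+ q :+ t) refl
      (E i j) (δ x v i j) (δ y v i j) (toggles P i j)
    where open xor-∧-Solver

  ⊕-other-column : ∀ (E : Edges n) x v y i j → v ≢ j → (E ⊕ δ x v ⊕ δ y v) i j ≡ E i j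
  ⊕-other-column E x v y i j v≢j = trans (⊕-missed (E ⊕ δ x v) (δ y v) i j (δ-missʳ y v i j v≢j))
    (⊕-missed E (δ x v) i j (δ-missʳ x v i j v≢j))

  ⊕-other-row : ∀ (E : Edges n) x v y → x ≢ y → (E ⊕ δ x v) y v ≡ E y v
  ⊕-other-row E x v y x≢y = ⊕-missed E (δ x v) y v (δ-missˡ x v y v x≢y)

  -- Each step removes two distinct pairs from a column that the rest of the walk avoids, so the
  -- later pairs are still present when their turn comes.
  edgeCount-toggles : ∀ (E : Edges n) (P : Walk b a) → Unique (columns P) →
    Along (λ x v y → E x v ≡ true × E y v ≡ true × x ≢ y) P →
    edgeCount (E ⊕ toggles P) + 2 ℕ.* length P ≡ edgeCount E
  edgeCount-toggles E [] _ _ =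
    trans (ℕ.+-identityʳ _) (sum-cong-≗ λ i → count-cong λ j → 𝔹.xor-identityʳ (E i j))
  edgeCount-toggles {a = x} E (step v {y} P) (v# ∷ uniq) ((Exv , Eyv , x≢y) , along) = begin
    edgeCount (E ⊕ toggles {a = x} (step v P)) + 2 ℕ.* suc (length P)
      ≡⟨ cong₂ _+_ (sum-cong-≗ λ i → count-cong (⊕-step E x v y P i)) (ℕ.*-suc 2 (length P)) ⟩
    edgeCount (E″ ⊕ toggles P) + (2 + 2 ℕ.* length P)
      ≡⟨ ℕ+.x∙yz≈y∙xz (edgeCount (E″ ⊕ toggles P)) 2 (2 ℕ.* length P) ⟩
    2 + (edgeCount (E″ ⊕ toggles P) + 2 ℕ.* length P)
      ≡⟨ cong (2 +_) (edgeCount-toggles E″ P uniq along″) ⟩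
    2 + edgeCount E″
      ≡⟨ cong suc (edgeCount-flip (E ⊕ δ x v) y v (trans (⊕-other-row E x v y x≢y) Eyv)) ⟩
    suc (edgeCount (E ⊕ δ x v))
      ≡⟨ edgeCount-flip E x v Exv ⟩
    edgeCount E ∎
    where
    open ≡-Reasoning
    E″ = E ⊕ δ x v ⊕ δ y v
    along″ = Along-map P (λ {x′} {v′} {y′} v′∈P (e , f , x≢y) →
      trans (⊕-other-column E x v y x′ v′ (All.lookup v# v′∈P)) e ,
      trans (⊕-other-column E x v y y′ v′ (All.lookup v# v′∈P)) f , x≢y) along

  module _ (E : Edges n) (x v y : Fin n) (Exv : E x v ≡ true) (Eyv : E y v ≡ false) where

    private
      E′ = E ⊕ δ x v
      E′yv = trans (⊕-other-row E x v y (differentRows E Exv Eyv)) Eyv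

    row-step : ∀ i → count ((E′ ⊕ δ y v) i) + ι x i ≡ count (E i) + ι y i
    row-step i = begin
      count ((E′ ⊕ δ y v) i) + ι x i     ≡⟨ cong (_+ ι x i) (row-flip-false E′ y v i E′yv) ⟩
      count (E′ i) + ι y i + ι x i       ≡⟨ ℕ+.xy∙z≈xz∙y (count (E′ i)) (ι y i) (ι x i) ⟩
      count (E′ i) + ι x i + ι y i       ≡⟨ cong (_+ ι y i) (row-flip-true E x v i Exv) ⟩
      count (E i) + ι y i                ∎
      where open ≡-Reasoning

    column-step : ∀ j → count (((E′ ⊕ δ y v) ᵀ) j) ≡ count ((E ᵀ) j)
    column-step j = begin
      count (((E′ ⊕ δ y v) ᵀ) j)         ≡⟨ column-flip E′ y v j ⟩
      count ((E′ ᵀ ⊕ δ v y) j)           ≡⟨ row-flip-false (E′ ᵀ) v y j E′yv ⟩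
      count ((E′ ᵀ) j) + ι v j           ≡⟨ cong (_+ ι v j) (column-flip E x v j) ⟩
      count ((E ᵀ ⊕ δ v x) j) + ι v j    ≡⟨ row-flip-true (E ᵀ) v x j Exv ⟩
      count ((E ᵀ) j)                    ∎
      where open ≡-Reasoning

  Alternating-step : ∀ (E : Edges n) x v y (P : Walk b y) → All (v ≢_) (columns P) →
                     Alternating E P → Alternating (E ⊕ δ x v ⊕ δ y v) P
  Alternating-step E x v y P v# = Alternating-cong P λ i {j} j∈P →
    ⊕-other-column E x v y i j (All.lookup v# j∈P)

  -- Each step moves one unit of out-degree from its first row to its second. These moves telescope
  -- to one from `a` to `b`, which cancels when the walk is closed.
  row-toggles : ∀ (E : Edges n) (P : Walk b a) → Unique (columns P) → Alternating E P →
                ∀ i → count ((E ⊕ toggles P) i) + ι a i ≡ count (E i) + ι b i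
  row-toggles {b} E [] _ _ i = cong (_+ ι b i) (count-cong λ j → 𝔹.xor-identityʳ (E i j))
  row-toggles {b} {x} E (step v {y} P) (v# ∷ uniq) ((Exv , Eyv , _) , alt) i =
    ℕ.+-cancelʳ-≡ (ι y i) _ _ (begin
    count ((E ⊕ toggles {a = x} (step v P)) i) + ι x i + ι y i
      ≡⟨ cong (λ c → c + ι x i + ι y i) (count-cong (⊕-step E x v y P i)) ⟩
    count ((E″ ⊕ toggles P) i) + ι x i + ι y i
      ≡⟨ ℕ+.xy∙z≈xz∙y _ (ι x i) (ι y i) ⟩
    count ((E″ ⊕ toggles P) i) + ι y i + ι x i
      ≡⟨ cong (_+ ι x i) (row-toggles E″ P uniq (Alternating-step E x v y P v# alt) i) ⟩
    count (E″ i) + ι b i + ι x i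
      ≡⟨ ℕ+.xy∙z≈xz∙y _ (ι b i) (ι x i) ⟩
    count (E″ i) + ι x i + ι b i
      ≡⟨ cong (_+ ι b i) (row-step E x v y Exv Eyv i) ⟩
    count (E i) + ι y i + ι b i
      ≡⟨ ℕ+.xy∙z≈xz∙y _ (ι y i) (ι b i) ⟩
    count (E i) + ι b i + ι y i ∎)
    where
    open ≡-Reasoning
    E″ = E ⊕ δ x v ⊕ δ y v

  column-toggles : ∀ (E : Edges n) (P : Walk b a) → Unique (columns P) → Alternating E P →
                   ∀ j → count (((E ⊕ toggles P) ᵀ) j) ≡ count ((E ᵀ) j)
  column-toggles E [] _ _ j = count-cong λ i → 𝔹.xor-identityʳ (E i j)
  column-toggles {b} {x} E (step v {y} P) (v# ∷ uniq) ((Exv , Eyv , _) , alt) j = begin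
    count (((E ⊕ toggles {a = x} (step v P)) ᵀ) j)
      ≡⟨ count-cong (λ i → ⊕-step E x v y P i j) ⟩
    count (((E″ ⊕ toggles P) ᵀ) j)
      ≡⟨ column-toggles E″ P uniq (Alternating-step E x v y P v# alt) j ⟩
    count ((E″ ᵀ) j)
      ≡⟨ column-step E x v y Exv Eyv j ⟩
    count ((E ᵀ) j) ∎
    where
    open ≡-Reasoning
    E″ = E ⊕ δ x v ⊕ δ y v

  SameDegrees : Digraph n → Digraph n → Set
  SameDegrees G H = (∀ i → outDegree G i ≡ outDegree H i) × (∀ i → inDegree G i ≡ inDegree H i)

  flipAlong-degrees : ∀ (G : Digraph n) (W : Walk a a) → Unique (columns W) →
                      (alt : Alternating (edge G) W) → SameDegrees (flipAlong G W alt) G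
  flipAlong-degrees {a} G W uniq alt =
    (λ i → ℕ.+-cancelʳ-≡ (ι a i) _ _ (row-toggles (edge G) W uniq alt i)) ,
    column-toggles (edge G) W uniq alt

-- Exchange between sets of equal size, and least witnesses.

∑-mono-≤ : ∀ {n} {f g : Fin n → ℕ} → (∀ i → f i ℕ.≤ g i) → ∑ f ℕ.≤ ∑ g
∑-mono-≤ {zero}  f≤g = z≤n
∑-mono-≤ {suc n} f≤g = ℕ.+-mono-≤ (f≤g zero) (∑-mono-≤ (f≤g ∘ suc))

∑-mono-< : ∀ {n} {f g : Fin n → ℕ} k → (∀ i → f i ℕ.≤ g i) → f k < g k → ∑ f < ∑ g
∑-mono-< zero    f≤g fk<gk = ℕ.+-mono-<-≤ fk<gk (∑-mono-≤ (f≤g ∘ suc))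
∑-mono-< (suc k) f≤g fk<gk = ℕ.+-mono-≤-< (f≤g zero) (∑-mono-< k (f≤g ∘ suc) fk<gk)

-- Otherwise `q` would be a proper subset of `p` and have fewer elements. This is the local balance
-- that lets an alternating walk always continue.
exchange : ∀ {n} {p q : Fin n → Bool} → count p ≡ count q → ∀ k → p k ≡ true → q k ≡ false →
           ∃ λ j → p j ≡ false × q j ≡ true
exchange {p = p} {q} ∣p∣≡∣q∣ k pk ¬qk
  with Fin.any? (λ j → p j 𝔹.≟ false ×-dec q j 𝔹.≟ true)
... | yes found = found
... | no ¬found = contradiction (sym ∣p∣≡∣q∣) (ℕ.<⇒≢ (∑-mono-< k q≤p q<p))
  where
  q≤p : ∀ j → [ q j ] ℕ.≤ [ p j ]
  q≤p j with p j in pj | q j in qj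
  ... | true  | true  = ℕ.≤-refl
  ... | _     | false = z≤n
  ... | false | true  = contradiction (j , pj , qj) ¬found
  q<p : [ q k ] < [ p k ]
  q<p rewrite pk | ¬qk = z<s

-- Serves twice: for least periods and for the minimality in `Dist`.
least : ∀ {P : ℕ → Set} → (∀ k → Dec (P k)) → ∀ k → P k →
        ∃ λ l → l ℕ.≤ k × P l × (∀ j → P j → l ℕ.≤ j)
least {P} P? = <-rec _ search
  where
  search : ∀ k → (∀ {j} → j < k → P j → ∃ λ l → l ℕ.≤ j × P l × (∀ j → P j → l ℕ.≤ j)) →
           P k → ∃ λ l → l ℕ.≤ k × P l × (∀ j → P j → l ℕ.≤ j)
  search k smaller Pk with ℕ.anyUpTo? P? k
  ... | yes (j , j<k , Pj) = let l , l≤j , Pl = smaller j<k Pj in l , ℕ.≤-trans l≤j (ℕ.<⇒≤ j<k) , Pl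
  ... | no ¬smaller        = k , ℕ.≤-refl , Pk , λ j Pj → ℕ.≮⇒≥ λ j<k → ¬smaller (j , j<k , Pj)

-- Periodic orbits of a self-map of a finite set.

iterate : {A : Set} → (A → A) → ℕ → A → A
iterate f zero    x = x
iterate f (suc k) x = iterate f k (f x)

iterate-+ : {A : Set} (f : A → A) → ∀ k l x → iterate f (k + l) x ≡ iterate f l (iterate f k x)
iterate-+ f zero    l x = refl
iterate-+ f (suc k) l x = iterate-+ f k l (f x)

iterate-suc : {A : Set} (f : A → A) → ∀ k x → iterate f (suc k) x ≡ f (iterate f k x)
iterate-suc f zero    x = refl
iterate-suc f (suc k) x = iterate-suc f k (f x)

module _ {n : ℕ} (f : Fin n → Fin n) where

  -- f is iterated suc l times, so that l ranges over periods minus one.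
  Period : Fin n → ℕ → Set
  Period x l = iterate f (suc l) x ≡ x

  -- Two of the `n + 1` iterates with exponents `0` to `n` coincide by the pigeonhole principle;
  -- their distance `suc l` is a period of the earlier one and is at most `n`.
  eventuallyPeriodic : ∀ u → ∃₂ λ k l → l < n × Period (iterate f k u) l
  eventuallyPeriodic u with Fin.pigeonhole (ℕ.n<1+n n) (λ i → iterate f (toℕ i) u)
  ... | i , j , i<j , eq with ℕ.m≤n⇒∃[o]m+o≡n i<j
  ...   | l , i+l≡j = toℕ i , l , l<n , (begin
      iterate f (suc l) (iterate f (toℕ i) u) ≡⟨ iterate-+ f (toℕ i) (suc l) u ⟨
      iterate f (toℕ i + suc l) u             ≡⟨ cong (λ k → iterate f k u) 1+i+l≡j ⟩
      iterate f (toℕ j) u                     ≡⟨ eq ⟨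
      iterate f (toℕ i) u                     ∎)
    where
    open ≡-Reasoning
    1+i+l≡j : toℕ i + suc l ≡ toℕ j
    1+i+l≡j = trans (ℕ.+-suc (toℕ i) l) i+l≡j
    l<n : l < n
    l<n = ℕ.≤-trans (s≤s (ℕ.m≤n+m l (toℕ i)))
      (ℕ.≤-trans (ℕ.≤-reflexive i+l≡j) (ℕ.≤-pred (Fin.toℕ<n j)))

  leastPeriod : ∀ u → ∃₂ λ k l → l < n × Period (iterate f k u) l ×
                (∀ j → Period (iterate f k u) j → l ℕ.≤ j)
  leastPeriod u =
    let k , l₀ , l₀<n , per₀ = eventuallyPeriodic u
        l , l≤l₀ , per , min = least (λ j → iterate f (suc j) (iterate f k u) ≟ iterate f k u) l₀ per₀
    in k , l , ℕ.≤-<-trans l≤l₀ l₀<n , per , min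

  -- If iterates `suc i` and `suc j` agreed, applying `f` another `l ∸ j` times would bring both to
  -- `x`, giving a period shorter than the least one. Exponents start at one to match `rows`, where
  -- the base point comes last.
  orbit-distinct : ∀ x l → Period x l → (∀ j → Period x j → l ℕ.≤ j) →
                   ∀ {i j} → i < j → j < suc l → iterate f (suc i) x ≢ iterate f (suc j) x
  orbit-distinct x l per min {i} {j} i<j (s≤s j≤l) eq with ℕ.m≤n⇒∃[o]m+o≡n j≤l
  ... | d , refl = ℕ.<⇒≱ (ℕ.+-monoˡ-< d i<j) (min (i + d) (begin
      iterate f (suc i + d) x             ≡⟨ iterate-+ f (suc i) d x ⟩
      iterate f d (iterate f (suc i) x)   ≡⟨ cong (iterate f d) eq ⟩
      iterate f d (iterate f (suc j) x)   ≡⟨ iterate-+ f (suc j) d x ⟨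
      iterate f (suc j + d) x             ≡⟨ per ⟩
      x                                   ∎))
    where open ≡-Reasoning

module _ {n : ℕ} (g h : Fin n → Fin n) where

  private
    f : Fin n → Fin n
    f = h ∘ g

  -- The end point is fixed by an equation, so that an orbit returning to its start is directly a
  -- closed walk.
  orbit : ∀ {b} k u → iterate f k u ≡ b → Walk b u
  orbit zero    u refl = []
  orbit (suc k) u eq   = step (g u) (orbit k (f u) eq)

  rows-orbit : ∀ {b} k u (eq : iterate f k u ≡ b) →
               rows (orbit k u eq) ≡ applyUpTo (λ i → iterate f (suc i) u) k
  rows-orbit zero    u refl = refl
  rows-orbit (suc k) u eq   = cong (f u ∷_) (rows-orbit k (f u) eq)

  -- Since the rows are images of the columns, distinct rows force distinct columns.
  rows-columns : ∀ {b} k u (eq : iterate f k u ≡ b) →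
                 rows (orbit k u eq) ≡ List.map h (columns (orbit k u eq))
  rows-columns zero    u refl = refl
  rows-columns (suc k) u eq   = cong (f u ∷_) (rows-columns k (f u) eq)

  length-orbit : ∀ {b} k u (eq : iterate f k u ≡ b) → length (orbit k u eq) ≡ k
  length-orbit zero    u refl = refl
  length-orbit (suc k) u eq   = cong suc (length-orbit k (f u) eq)

  Along-orbit : ∀ {S : StepPredicate} {Active : Fin n → Set} {b} →
                (∀ u → Active u → S u (g u) (f u)) → (∀ u → Active u → Active (f u)) →
                ∀ k u (eq : iterate f k u ≡ b) → Active u → Along S (orbit k u eq)
  Along-orbit S-step active zero    u refl act = tt
  Along-orbit S-step active (suc k) u eq   act =
    S-step u act , Along-orbit S-step active k (f u) eq (active u act)

  iterate-active : ∀ {Active : Fin n → Set} → (∀ u → Active u → Active (f u)) →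
                   ∀ k u → Active u → Active (iterate f k u)
  iterate-active active zero    u act = act
  iterate-active active (suc k) u act = iterate-active active k (f u) (active u act)

-- An alternating cycle between two graphs with equal degrees.

module _ {n : ℕ} (G H : Digraph n) (sameDegrees : SameDegrees G H) where

  private
    out = proj₁ sameDegrees
    inn = proj₂ sameDegrees

  Removed Added : Fin n → Fin n → Set
  Removed u v = edge G u v ≡ true  × edge H u v ≡ false
  Added   u v = edge G u v ≡ false × edge H u v ≡ true

  removed? : ∀ u → Dec (∃ (Removed u))
  removed? u = Fin.any? λ v → edge G u v 𝔹.≟ true ×-dec edge H u v 𝔹.≟ false

  added? : ∀ v → Dec (∃ λ u → Added u v)
  added? v = Fin.any? λ u → edge G u v 𝔹.≟ false ×-dec edge H u v 𝔹.≟ true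

  -- Fixing one choice of an edge for every vertex makes the walk deterministic, so that a
  -- least period of the return map to the out-copies is a cycle without repeated vertices.
  nextColumn nextRow : Fin n → Fin n
  nextColumn u with removed? u
  ... | yes (v , _) = v
  ... | no _        = u
  nextRow v with added? v
  ... | yes (u , _) = u
  ... | no _        = v

  Active : Fin n → Set
  Active u = ∃ (Removed u)

  removed-next : ∀ u → Active u → Removed u (nextColumn u)
  removed-next u act with removed? u
  ... | yes (_ , r) = r
  ... | no ¬act     = contradiction act ¬act

  -- Equal in-degrees: a column that loses a pair must gain one. Dually, `active-next` uses equal
  -- out-degrees, so the walk never gets stuck.
  added-next : ∀ {u} v → Removed u v → Added (nextRow v) v
  added-next v r with added? v
  ... | yes (_ , a) = a
  ... | no ¬a       = contradiction (exchange (inn v) _ (proj₁ r) (proj₂ r)) ¬a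

  active-next : ∀ u → Active u → Active (nextRow (nextColumn u))
  active-next u act =
    let g , h = added-next (nextColumn u) (removed-next u act)
        v , h′ , g′ = exchange (sym (out (nextRow (nextColumn u)))) (nextColumn u) h g
    in v , g′ , h′

  active : ¬ (edge G ≐ edge H) → ∃ Active
  active G≢H with Fin.any? removed?
  ... | yes act = act
  ... | no ¬act = contradiction G≐H G≢H
    where
    G≐H : edge G ≐ edge H
    G≐H i j with edge G i j in Gij | edge H i j in Hij
    ... | true  | true  = refl
    ... | false | false = refl
    ... | true  | false = contradiction (i , j , Gij , Hij) ¬act
    -- A pair present only in `H` forces, by equal out-degrees, a pair present only in `G` in the
    -- same row.
    ... | false | true  =
      let v , h , g = exchange (sym (out i)) j Hij Gij in contradiction (i , v , g , h) ¬act

  record AlternatingCycle (x : Fin n) : Set where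
    field
      v y           : Fin n
      Q             : Walk x y
    W : Walk x x
    W = step v Q
    field
      uniqueColumns : Unique (columns W)
      uniqueRows    : Unique (rows W)
      short         : length W ℕ.≤ n
      along         : Along (λ x v y → Removed x v × Added y v) W

  alternatingCycle : ¬ (edge G ≐ edge H) → ∃ AlternatingCycle
  alternatingCycle G≢H =
    let u , act = active G≢H
        g = nextColumn
        h = nextRow
        f = h ∘ g
        -- The active vertex `u` may lie on a tail leading into the cycle; the iterate `x` lies on
        -- the cycle itself and is still active.
        k , l , l<n , per , min = leastPeriod f u
        x = iterate f k u
        W = orbit g h (suc l) x per
        uniq = subst Unique (sym (rows-orbit g h (suc l) x per))
                 (Unique.applyUpTo⁺₁ _ (suc l) (orbit-distinct f x l per min))
    in x , record
      { Q             = orbit g h l (f x) per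
      ; uniqueColumns = Unique.map⁻ (subst Unique (rows-columns g h (suc l) x per) uniq)
      ; uniqueRows    = uniq
      ; short         = ℕ.≤-trans (ℕ.≤-reflexive (length-orbit g h (suc l) x per)) l<n
      ; along         = Along-orbit g h
          (λ u act → removed-next u act , added-next (g u) (removed-next u act))
          active-next (suc l) x per (iterate-active g h active-next k u act)
      }

-- Reaching the target by flipping cycles.

module _ {n : ℕ} where

  infix 4 _≐?_

  _≐?_ : (E F : Edges n) → Dec (E ≐ F)
  E ≐? F = Fin.all? λ i → Fin.all? λ j → E i j 𝔹.≟ F i j

  -- The inequality is `w ≤ H′ · (1 - 1/n)` multiplied by `2n`, with the negative term moved to the
  -- left. The number `m` bounds the difference and is the recursion measure.
  connect : ∀ m (G H : Digraph n) → SameDegrees G H → ∣ G Δ H ∣ ℕ.≤ m →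
            ∃ λ w → Swaps G H w × 2 ℕ.* n ℕ.* w + ∣ G Δ H ∣ ℕ.≤ n ℕ.* ∣ G Δ H ∣
  connect m G H same Δ≤m with edge G ≐? edge H
  ... | yes G≐H = 0 , done G≐H , ℕ.≤-reflexive (begin
      2 ℕ.* n ℕ.* 0 + ∣ G Δ H ∣  ≡⟨ cong₂ _+_ (ℕ.*-zeroʳ (2 ℕ.* n)) Δ≡0 ⟩
      0                      ≡⟨ ℕ.*-zeroʳ n ⟨
      n ℕ.* 0                  ≡⟨ cong (n ℕ.*_) Δ≡0 ⟨
      n ℕ.* ∣ G Δ H ∣          ∎)
    where
    open ≡-Reasoning
    ∑0 : ∀ k → ∑ {k} (λ _ → 0) ≡ 0
    ∑0 zero    = refl
    ∑0 (suc k) = ∑0 k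
    Δ≡0 : ∣ G Δ H ∣ ≡ 0
    Δ≡0 = trans (sum-cong-≗ λ i → trans
      (count-cong λ j → trans (cong (_xor edge H i j) (G≐H i j)) (𝔹.xor-same (edge H i j)))
      (∑0 n)) (∑0 n)
  ... | no G≢H = extend m Δ≤m
    where
    cycle = alternatingCycle G H same G≢H
    open AlternatingCycle (proj₂ cycle)

    notLoop : ∀ (K : Digraph n) {i j} → edge K i j ≡ true → i ≢ j
    notLoop K Kij refl = contradiction (trans (sym Kij) (loopless K _)) λ ()

    alt : Alternating (edge G) W
    alt = Along-map W (λ _ ((g , _) , (g′ , h′)) → g , g′ , notLoop G g , notLoop H h′) along

    M = flipAlong G W alt

    -- Toggling `W` in `G` also toggles it in the symmetric difference, which contains all its
    -- pairs; exactly two are lost per step.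
    Δ-shrinks : ∣ M Δ H ∣ + 2 ℕ.* length W ≡ ∣ G Δ H ∣
    Δ-shrinks = trans
      (cong (_+ 2 ℕ.* length W) (sum-cong-≗ λ i → count-cong λ j →
        solve 3 (λ g t h → (g :+ t) :+ h := (g :+ h) :+ t) refl
          (edge G i j) (toggles W i j) (edge H i j)))
      (edgeCount-toggles (edge G ⊕ edge H) W uniqueColumns
        (Along-map W (λ _ ((g , h) , (g′ , h′)) →
          cong₂ _xor_ g h , cong₂ _xor_ g′ h′ , differentRows (edge G) g g′) along))
      where open xor-∧-Solver

    sameM : SameDegrees M H
    sameM = let out , inn = flipAlong-degrees G W uniqueColumns alt in
      (λ i → trans (out i) (proj₁ same i)) , (λ i → trans (inn i) (proj₂ same i))

    extend : ∀ m → ∣ G Δ H ∣ ℕ.≤ m →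
             ∃ λ w → Swaps G H w × 2 ℕ.* n ℕ.* w + ∣ G Δ H ∣ ℕ.≤ n ℕ.* ∣ G Δ H ∣
    extend zero Δ≤0 = contradiction (trans Δ-shrinks (ℕ.n≤0⇒n≡0 Δ≤0))
      (λ eq → contradiction (ℕ.m+n≡0⇒n≡0 ∣ M Δ H ∣ eq) λ ())
    extend (suc m) Δ≤m =
      let w , swaps , bound = connect m M H sameM M≤m
      in length Q + w ,
         solve-cycle v Q uniqueColumns uniqueRows alt (λ _ _ → refl) swaps ,
         (begin
           2 ℕ.* n ℕ.* (length Q + w) + ∣ G Δ H ∣
             ≡⟨ cong (λ d → 2 ℕ.* n ℕ.* (length Q + w) + d) Δ-shrinks ⟨
           2 ℕ.* n ℕ.* (length Q + w) + (∣ M Δ H ∣ + 2 ℕ.* length W)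
             ≡⟨ solve 4 (λ n q w d →
                  con 2 :* n :* (q :+ w) :+ (d :+ con 2 :* (con 1 :+ q)) :=
                  con 2 :* n :* w :+ d :+ con 2 :* (n :* q :+ (con 1 :+ q)))
                refl n (length Q) w ∣ M Δ H ∣ ⟩
           2 ℕ.* n ℕ.* w + ∣ M Δ H ∣ + 2 ℕ.* (n ℕ.* length Q + length W)
             -- With ℓ the length of `W`, the hypothesis ℓ ≤ n enters here as n(ℓ - 1) + ℓ ≤ nℓ.
             ≤⟨ ℕ.+-mono-≤ bound (ℕ.*-monoʳ-≤ 2 (ℕ.+-monoʳ-≤ (n ℕ.* length Q) short)) ⟩
           n ℕ.* ∣ M Δ H ∣ + 2 ℕ.* (n ℕ.* length Q + n)
             ≡⟨ solve 3 (λ n q d →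
                  n :* d :+ con 2 :* (n :* q :+ n) := n :* (d :+ con 2 :* (con 1 :+ q)))
                refl n (length Q) ∣ M Δ H ∣ ⟩
           n ℕ.* (∣ M Δ H ∣ + 2 ℕ.* length W)
             ≡⟨ cong (n ℕ.*_) Δ-shrinks ⟩
           n ℕ.* ∣ G Δ H ∣ ∎)
      where
      open ℕ.≤-Reasoning
      open +-*-Solver
      M≤m : ∣ M Δ H ∣ ℕ.≤ m
      M≤m = ℕ.≤-pred (ℕ.≤-trans (ℕ.≤-trans
        (ℕ.≤-reflexive (ℕ.+-comm 1 _)) (ℕ.+-monoʳ-≤ ∣ M Δ H ∣ (s≤s z≤n)))
        (ℕ.≤-trans (ℕ.≤-reflexive Δ-shrinks) Δ≤m))

  -- Decidability of swap sequences and existence of the distance.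

  puts-cong : ∀ {E F : Edges n} ps → E ≐ F → puts ps E ≐ puts ps F
  puts-cong []                 E≐F = E≐F
  puts-cong ((b , u , v) ∷ ps) E≐F = put-cong b u v (puts-cong ps E≐F)

  ≐-trans : ∀ {E F F′ : Edges n} → E ≐ F → F ≐ F′ → E ≐ F′
  ≐-trans E≐F F≐F′ i j = trans (E≐F i j) (F≐F′ i j)

  c₄-puts : (x y z t : Fin n) → List (Put n)
  c₄-puts x y z t = (true , x , t) ∷ (true , z , y) ∷ (false , x , y) ∷ (false , z , t) ∷ []

  c₆-puts : (x y z : Fin n) → List (Put n)
  c₆-puts x y z = (true , y , x) ∷ (true , z , y) ∷ (true , x , z) ∷
                  (false , x , y) ∷ (false , y , z) ∷ (false , z , x) ∷ []

  -- Graphs with pointwise equal edges need not be propositionally equal. Only the first swap has to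
  -- be re-based; the rest of the sequence is kept.
  Swaps-resp-≐ : ∀ {G H K : Digraph n} {w} → edge H ≐ edge G → Swaps G K w → Swaps H K w
  Swaps-resp-≐ H≐G (done G≐K) = done (≐-trans H≐G G≐K)
  Swaps-resp-≐ H≐G (c₄ (c₄-swap x y z t uniq xy zt xt zy M≐) rest) =
    c₄ (c₄-swap x y z t uniq
          (trans (H≐G x y) xy) (trans (H≐G z t) zt) (trans (H≐G x t) xt) (trans (H≐G z y) zy)
          (≐-trans M≐ (puts-cong (c₄-puts x y z t) λ i j → sym (H≐G i j))))
       rest
  Swaps-resp-≐ H≐G (c₆ (c₆-swap x y z uniq xy yz zx yx zy xz M≐) rest) =
    c₆ (c₆-swap x y z uniq
          (trans (H≐G x y) xy) (trans (H≐G y z) yz) (trans (H≐G z x) zx)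
          (trans (H≐G y x) yx) (trans (H≐G z y) zy) (trans (H≐G x z) xz)
          (≐-trans M≐ (puts-cong (c₆-puts x y z) λ i j → sym (H≐G i j))))
       rest

  OffDiagonal : Put n → Set
  OffDiagonal (_ , u , v) = u ≢ v

  puts-loopless : ∀ {E : Edges n} → (∀ i → E i i ≡ false) → ∀ ps → All OffDiagonal ps →
                  ∀ i → puts ps E i i ≡ false
  puts-loopless E-loopless []                 []         i = E-loopless i
  puts-loopless {E} E-loopless ((b , u , v) ∷ ps) (u≢v ∷ hs) i
    rewrite put-if b u v (puts ps E) i i with u ≟ i | v ≟ i
  ... | yes refl | yes refl = contradiction refl u≢v
  ... | yes refl | no _     = puts-loopless E-loopless ps hs i
  ... | no _     | _        = puts-loopless E-loopless ps hs i

  putsᴳ : ∀ (G : Digraph n) ps → All OffDiagonal ps → Digraph n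
  putsᴳ G ps off .edge     = puts ps (edge G)
  putsᴳ G ps off .loopless = puts-loopless (loopless G) ps off

  c₄-offDiagonal : ∀ {x y z t} → Unique (x ∷ y ∷ z ∷ t ∷ []) → All OffDiagonal (c₄-puts x y z t)
  c₄-offDiagonal ((x≢y ∷ x≢z ∷ x≢t ∷ []) ∷ (y≢z ∷ y≢t ∷ []) ∷ (z≢t ∷ []) ∷ _) =
    x≢t ∷ y≢z ∘ sym ∷ x≢y ∷ z≢t ∷ []

  c₆-offDiagonal : ∀ {x y z} → Unique (x ∷ y ∷ z ∷ []) → All OffDiagonal (c₆-puts x y z)
  c₆-offDiagonal ((x≢y ∷ x≢z ∷ []) ∷ (y≢z ∷ []) ∷ _) =
    x≢y ∘ sym ∷ y≢z ∘ sym ∷ x≢z ∷ x≢y ∷ y≢z ∷ x≢z ∘ sym ∷ []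

  flips? : ∀ (E : Edges n) ps → Dec (All (Flips E) ps)
  flips? E = All.all? λ (b , u , v) → E u v 𝔹.≟ not b

  -- Any graph reached by a swap may be replaced by the canonical one, and only finitely many
  -- of those exist.
  CanonicalSwap : (G K : Digraph n) → ℕ → ∀ {vs : List (Fin n)} ps →
                  (Unique vs → All OffDiagonal ps) → Set
  CanonicalSwap G K w {vs} ps off =
    Σ[ uniq ∈ Unique vs ] All (Flips (edge G)) ps × Swaps (putsᴳ G ps (off uniq)) K w

  canonicalSwap? : ∀ {G K w} {vs : List (Fin n)} ps (off : Unique vs → All OffDiagonal ps) →
                   (∀ G → Dec (Swaps G K w)) → Dec (CanonicalSwap G K w ps off)
  canonicalSwap? {G} {K} {w} {vs} ps off swaps? with DecUnique.unique? _≟_ vs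
  ... | no ¬uniq = no (¬uniq ∘ proj₁)
  ... | yes uniq = map′ (uniq ,_)
    -- Another proof of uniqueness may change the `loopless` field of the graph but not its edges.
    (λ (_ , flips , rest) → flips , Swaps-resp-≐ (λ _ _ → refl) rest)
    (flips? (edge G) ps ×-dec swaps? (putsᴳ G ps (off uniq)))

  C₄-first C₆-first : (G K : Digraph n) → ℕ → Set
  C₄-first G K w = ∃ λ x → ∃ λ y → ∃ λ z → ∃ λ t →
    CanonicalSwap G K w (c₄-puts x y z t) (c₄-offDiagonal {x} {y} {z} {t})
  C₆-first G K w = ∃ λ x → ∃ λ y → ∃ λ z →
    CanonicalSwap G K w (c₆-puts x y z) (c₆-offDiagonal {x} {y} {z})

  C₄-first? : ∀ G K w → (∀ G → Dec (Swaps G K w)) → Dec (C₄-first G K w)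
  C₄-first? G K w swaps? = Fin.any? λ x → Fin.any? λ y → Fin.any? λ z → Fin.any? λ t →
    canonicalSwap? (c₄-puts x y z t) c₄-offDiagonal swaps?

  C₆-first? : ∀ G K w → (∀ G → Dec (Swaps G K w)) → Dec (C₆-first G K w)
  C₆-first? G K w swaps? = Fin.any? λ x → Fin.any? λ y → Fin.any? λ z →
    canonicalSwap? (c₆-puts x y z) c₆-offDiagonal swaps?

  fromC₄-first : ∀ G {K w} → C₄-first G K w → Swaps G K (1 + w)
  fromC₄-first G (x , y , z , t , uniq , xt ∷ zy ∷ xy ∷ zt ∷ [] , rest) =
    c₄ (c₄-swap x y z t uniq xy zt xt zy λ _ _ → refl) rest

  fromC₆-first : ∀ G {K w} → C₆-first G K w → Swaps G K (2 + w)
  fromC₆-first G (x , y , z , uniq , yx ∷ zy ∷ xz ∷ xy ∷ yz ∷ zx ∷ [] , rest) =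
    c₆ (c₆-swap x y z uniq xy yz zx yx zy xz λ _ _ → refl) rest

  toC₄-first : ∀ {G H K w} → C₄-Swap G H → Swaps H K w → C₄-first G K w
  toC₄-first (c₄-swap x y z t uniq xy zt xt zy H≐) rest =
    x , y , z , t , uniq , xt ∷ zy ∷ xy ∷ zt ∷ [] ,
    Swaps-resp-≐ (λ i j → sym (H≐ i j)) rest

  toC₆-first : ∀ {G H K w} → C₆-Swap G H → Swaps H K w → C₆-first G K w
  toC₆-first (c₆-swap x y z uniq xy yz zx yx zy xz H≐) rest =
    x , y , z , uniq , yx ∷ zy ∷ xz ∷ xy ∷ yz ∷ zx ∷ [] ,
    Swaps-resp-≐ (λ i j → sym (H≐ i j)) rest

  -- Every swap has positive weight, so the search descends on `w`. Weight 1 is separate because a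
  -- triangular swap does not fit into it.
  swaps? : ∀ w (G K : Digraph n) → Dec (Swaps G K w)
  swaps? 0 G K = map′ done (λ { (done G≐K) → G≐K }) (edge G ≐? edge K)
  swaps? 1 G K = map′ (fromC₄-first G) (λ { (c₄ s rest) → toC₄-first s rest })
    (C₄-first? G K 0 λ G → swaps? 0 G K)
  swaps? (suc (suc w)) G K = map′
    (λ { (inj₁ s) → fromC₄-first G s ; (inj₂ s) → fromC₆-first G s })
    (λ { (c₄ s rest) → inj₁ (toC₄-first s rest) ; (c₆ s rest) → inj₂ (toC₆-first s rest) })
    (C₄-first? G K (suc w) (λ G → swaps? (suc w) G K) ⊎-dec C₆-first? G K w (λ G → swaps? w G K))

  -- Deciding each smaller weight is what turns the existence of some sequence into a minimum
  -- constructively.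
  dist : ∀ {G H : Digraph n} {w} → Swaps G H w → ∃ λ d → d ℕ.≤ w × Dist G H d
  dist {G} {H} {w} swaps = let d , d≤w , min = least (λ w → swaps? w G H) w swaps in d , d≤w , min

  -- Degree bounds on the symmetric difference.

  count-xor-≤ : ∀ (p q : Fin n → Bool) → count (λ j → p j xor q j) ℕ.≤ count p + count q
  count-xor-≤ p q = ℕ.≤-trans (∑-mono-≤ λ j → bound (p j) (q j))
    (ℕ.≤-reflexive (∑-distrib-+ ([_] ∘ p) ([_] ∘ q)))
    where
    bound : ∀ b c → [ b xor c ] ℕ.≤ [ b ] + [ c ]
    bound true  true  = z≤n
    bound true  false = ℕ.≤-refl
    bound false c     = ℕ.≤-refl

  count-not : ∀ (p : Fin n → Bool) → count (not ∘ p) ≡ n ∸ count p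
  count-not p = sym (trans (cong (_∸ count p) (sym total)) (ℕ.m+n∸m≡n (count p) (count (not ∘ p))))
    where
    ∑1 : ∀ k → ∑ {k} (λ _ → 1) ≡ k
    ∑1 zero    = refl
    ∑1 (suc k) = cong suc (∑1 k)
    complement : ∀ b → [ b ] + [ not b ] ≡ 1
    complement true  = refl
    complement false = refl
    total : count p + count (not ∘ p) ≡ n
    total = trans (sym (∑-distrib-+ ([_] ∘ p) ([_] ∘ not ∘ p)))
      (trans (sum-cong-≗ (complement ∘ p)) (∑1 n))

  -- Two sets of size `d` differ in at most `2d` elements. Their complements have the same symmetric
  -- difference and size `n ∸ d`, which gives the other bound.
  count-xor-min : ∀ {d} (p q : Fin n → Bool) → count p ≡ d → count q ≡ d →
                  count (λ j → p j xor q j) ℕ.≤ 2 ℕ.* (d ⊓ (n ∸ d))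
  count-xor-min {d} p q ∣p∣ ∣q∣ = ℕ.≤-trans
    (ℕ.⊓-glb
      (ℕ.≤-trans (count-xor-≤ p q) (ℕ.≤-reflexive (double ∣p∣ ∣q∣)))
      (ℕ.≤-trans
        (ℕ.≤-reflexive (sym (count-cong λ j → 𝔹.xor-annihilates-not (p j) (q j))))
        (ℕ.≤-trans (count-xor-≤ (not ∘ p) (not ∘ q)) (ℕ.≤-reflexive
          (double (trans (count-not p) (cong (n ∸_) ∣p∣)) (trans (count-not q) (cong (n ∸_) ∣q∣)))))))
    (ℕ.≤-reflexive (sym (ℕ.*-distribˡ-⊓ 2 d (n ∸ d))))
    where
    double : ∀ {k l m} → k ≡ m → l ≡ m → k + l ≡ 2 ℕ.* m
    double {m = m} refl refl = cong (m +_) (sym (ℕ.+-identityʳ m))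

  module _ (d⁺ d⁻ : Fin n → ℕ) (G H : Digraph n) (rG : Realizes G d⁺ d⁻) (rH : Realizes H d⁺ d⁻) where

    -- The difference is counted once by rows and once by columns; the resulting factor 2 cancels
    -- against the one in `count-xor-min`.
    Δ≤m⋆ : ∣ G Δ H ∣ ℕ.≤ m⋆ d⁺ d⁻
    Δ≤m⋆ = ℕ.*-cancelˡ-≤ 2 (begin
      2 ℕ.* ∣ G Δ H ∣                           ≡⟨ cong (∣ G Δ H ∣ +_) (ℕ.+-identityʳ _) ⟩
      ∣ G Δ H ∣ + ∣ G Δ H ∣
        ≡⟨ cong (∣ G Δ H ∣ +_) (∑-comm λ i j → [ edge G i j xor edge H i j ]) ⟩
      ∣ G Δ H ∣ + edgeCount ((edge G ⊕ edge H) ᵀ)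
        ≤⟨ ℕ.+-mono-≤ (∑-mono-≤ rowBound) (∑-mono-≤ columnBound) ⟩
      ∑ (λ i → 2 ℕ.* min⁺ i) + ∑ (λ i → 2 ℕ.* min⁻ i)
        ≡⟨ cong₂ _+_ (∑-double min⁺) (∑-double min⁻) ⟩
      2 ℕ.* ∑ min⁺ + 2 ℕ.* ∑ min⁻                 ≡⟨ ℕ.*-distribˡ-+ 2 (∑ min⁺) (∑ min⁻) ⟨
      2 ℕ.* (∑ min⁺ + ∑ min⁻)                   ≡⟨ cong (2 ℕ.*_) (∑-distrib-+ min⁺ min⁻) ⟨
      2 ℕ.* m⋆ d⁺ d⁻                            ∎)
      where
      open ℕ.≤-Reasoning
      min⁺ min⁻ : Fin n → ℕ
      min⁺ i = d⁺ i ⊓ (n ∸ d⁺ i)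
      min⁻ i = d⁻ i ⊓ (n ∸ d⁻ i)
      rowBound : ∀ i → count (λ j → edge G i j xor edge H i j) ℕ.≤ 2 ℕ.* min⁺ i
      rowBound i = count-xor-min (edge G i) (edge H i) (proj₁ rG i) (proj₁ rH i)
      columnBound : ∀ j → count (λ i → edge G i j xor edge H i j) ℕ.≤ 2 ℕ.* min⁻ j
      columnBound j = count-xor-min (λ i → edge G i j) (λ i → edge H i j) (proj₂ rG j) (proj₂ rH j)
      ∑-double : ∀ (f : Fin n → ℕ) → ∑ (λ i → 2 ℕ.* f i) ≡ 2 ℕ.* ∑ f
      ∑-double f = trans (sum-cong-≗ λ i → cong (f i +_) (ℕ.+-identityʳ (f i)))
        (trans (∑-distrib-+ f f) (cong (∑ f +_) (sym (ℕ.+-identityʳ (∑ f)))))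

    m⋆≤2m : m⋆ d⁺ d⁻ ℕ.≤ 2 ℕ.* ∑ d⁺
    m⋆≤2m = begin
      m⋆ d⁺ d⁻                   ≤⟨ ∑-mono-≤ (λ i → ℕ.+-mono-≤ (ℕ.m⊓n≤m (d⁺ i) _) (ℕ.m⊓n≤m (d⁻ i) _)) ⟩
      ∑ (λ i → d⁺ i + d⁻ i)      ≡⟨ ∑-distrib-+ d⁺ d⁻ ⟩
      ∑ d⁺ + ∑ d⁻                ≡⟨ cong (∑ d⁺ +_) d⁻≡d⁺ ⟩
      ∑ d⁺ + ∑ d⁺                ≡⟨ cong (∑ d⁺ +_) (ℕ.+-identityʳ (∑ d⁺)) ⟨
      2 ℕ.* ∑ d⁺                   ∎
      where
      open ℕ.≤-Reasoning
      -- Both sums count the edges of `G`.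
      d⁻≡d⁺ : ∑ d⁻ ≡ ∑ d⁺
      d⁻≡d⁺ = trans (sum-cong-≗ (sym ∘ proj₂ rG))
        (trans (sym (∑-comm λ i j → [ edge G i j ])) (sum-cong-≗ (proj₁ rG)))

-- From rational inequalities to inequalities of natural numbers.

toℚᵘ-/ : ∀ p d → toℚᵘ (ℤ.+ p ℚ./ suc d) ℚᵘ.≃ mkℚᵘ (ℤ.+ p) d
toℚᵘ-/ p d = ℚ.toℚᵘ-fromℚᵘ (mkℚᵘ (ℤ.+ p) d)

mkℚᵘ-mono-≤ : ∀ {a b c d} → a ℕ.* suc d ℕ.≤ c ℕ.* suc b → mkℚᵘ (ℤ.+ a) b ℚᵘ.≤ mkℚᵘ (ℤ.+ c) d
mkℚᵘ-mono-≤ {a} {b} {c} {d} ad≤cb =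
  *≤* (subst₂ ℤ._≤_ (ℤ.pos-* a (suc d)) (ℤ.pos-* c (suc b)) (ℤ.+≤+ ad≤cb))

toℚᵘ-subtract : ∀ p q {P Q} → toℚᵘ p ℚᵘ.≃ P → toℚᵘ q ℚᵘ.≃ Q → toℚᵘ (p ℚ.- q) ℚᵘ.≃ P ℚᵘ.- Q
toℚᵘ-subtract p q p≃ q≃ = ℚᵘ.≃-trans (ℚ.toℚᵘ-homo-+ p (ℚ.- q))
  (ℚᵘ.+-cong p≃ (ℚᵘ.≃-trans (ℚ.toℚᵘ-homo‿- q) (ℚᵘ.-‿cong q≃)))

-- `mkℚᵘ` stores the denominator minus one, and `e + d * suc e` is that number for the product
-- `suc d * suc e`. Unnormalised fractions keep numerators and denominators explicit.
toℚᵘ-/-* : ∀ p d q {r e} → toℚᵘ q ℚᵘ.≃ mkℚᵘ (ℤ.+ r) e →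
           toℚᵘ (ℤ.+ p ℚ./ suc d ℚ.* q) ℚᵘ.≃ mkℚᵘ (ℤ.+ (p ℕ.* r)) (e + d ℕ.* suc e)
toℚᵘ-/-* p d q {r} {e} q≃ = ℚᵘ.≃-trans (ℚ.toℚᵘ-homo-* (ℤ.+ p ℚ./ suc d) q)
  (ℚᵘ.≃-trans (ℚᵘ.*-cong (toℚᵘ-/ p d) q≃)
    (ℚᵘ.≃-reflexive (cong (λ z → mkℚᵘ z (e + d ℕ.* suc e)) (sym (ℤ.pos-* p r)))))

1-1/n : ∀ k → toℚᵘ (1ℚ ℚ.- 1/ (suc k)) ℚᵘ.≃ mkℚᵘ (ℤ.+ k) k
1-1/n k = ℚᵘ.≃-trans (toℚᵘ-subtract 1ℚ (1/ (suc k)) ℚᵘ.≃-refl (toℚᵘ-/ 1 k)) (*≡* eq)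
  where
  open ℤ-Solver
  eq : (ℤ.+ 1 ℤ.* ℤ.+ suc k ℤ.+ ℤ.- ℤ.+ 1 ℤ.* ℤ.+ 1) ℤ.* ℤ.+ suc k ≡ ℤ.+ k ℤ.* ℤ.+ suc (k + 0)
  eq = trans
    (solve 1 (λ κ →
      (con (ℤ.+ 1) :* (con (ℤ.+ 1) :+ κ) :+ (:- con (ℤ.+ 1)) :* con (ℤ.+ 1)) :* (con (ℤ.+ 1) :+ κ)
        := κ :* (con (ℤ.+ 1) :+ κ)) refl (ℤ.+ k))
    (cong (λ l → ℤ.+ k ℤ.* ℤ.+ suc l) (sym (ℕ.+-identityʳ k)))

½-1/2n : ∀ k → toℚᵘ (½ ℚ.- 1/ (2 ℕ.* suc k)) ℚᵘ.≃ mkℚᵘ (ℤ.+ k) (pred (2 ℕ.* suc k))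
½-1/2n k = ℚᵘ.≃-trans
  (toℚᵘ-subtract ½ (1/ (2 ℕ.* suc k)) ℚᵘ.≃-refl (toℚᵘ-/ 1 (pred (2 ℕ.* suc k)))) (*≡* eq)
  where
  open ℤ-Solver
  N : ℕ
  N = 2 ℕ.* suc k
  N≡ : ℤ.+ N ≡ ℤ.+ 2 ℤ.* ℤ.+ suc k
  N≡ = ℤ.pos-* 2 (suc k)
  eq : (ℤ.+ 1 ℤ.* ℤ.+ N ℤ.+ ℤ.- ℤ.+ 1 ℤ.* ℤ.+ 2) ℤ.* ℤ.+ N ≡ ℤ.+ k ℤ.* ℤ.+ (2 ℕ.* N)
  eq = trans (cong (λ N → (ℤ.+ 1 ℤ.* N ℤ.+ ℤ.- ℤ.+ 1 ℤ.* ℤ.+ 2) ℤ.* N) N≡)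
    (trans
      (solve 1 (λ κ →
        let N = con (ℤ.+ 2) :* (con (ℤ.+ 1) :+ κ) in
        (con (ℤ.+ 1) :* N :+ (:- con (ℤ.+ 1)) :* con (ℤ.+ 2)) :* N := κ :* (con (ℤ.+ 2) :* N))
        refl (ℤ.+ k))
      (cong (ℤ.+ k ℤ.*_) (sym (trans (ℤ.pos-* 2 N) (cong (ℤ.+ 2 ℤ.*_) N≡)))))

theorem5p6 : (n : ℕ) .{{_ : NonZero n}} (d⁺ d⁻ : Fin n → ℕ) (G₁ G₂ : Digraph n) →
    Realizes G₁ d⁺ d⁻ → Realizes G₂ d⁺ d⁻ →
    ∃[ dist ] (Dist G₁ G₂ dist
    × fromℕ dist ≤ H′ G₁ G₂ * (1ℚ - 1/ n)
    × H′ G₁ G₂ * (1ℚ - 1/ n) ≤ fromℕ (m⋆ d⁺ d⁻) * (½ - 1/ (2 ℕ.* n) {{m*n≢0 2 n}})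
    × fromℕ (m⋆ d⁺ d⁻) * (½ - 1/ (2 ℕ.* n) {{m*n≢0 2 n}}) ≤ fromℕ (∑ d⁺) * (1ℚ - 1/ n))
theorem5p6 n@(suc k) d⁺ d⁻ G₁ G₂ r₁ r₂ =
  let w , swaps , bound = connect ∣ G₁ Δ G₂ ∣ G₁ G₂ same ℕ.≤-refl
      d , d≤w , isDist = dist swaps
  in d , isDist ,
     ℚ.toℚᵘ-cancel-≤ (between (toℚᵘ-/ d 0) H′-value (mkℚᵘ-mono-≤ (distance d≤w bound))) ,
     ℚ.toℚᵘ-cancel-≤ (between H′-value m⋆-value (mkℚᵘ-mono-≤ middle)) ,
     ℚ.toℚᵘ-cancel-≤ (between m⋆-value m-value (mkℚᵘ-mono-≤ last))
  where
  Δ = ∣ G₁ Δ G₂ ∣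
  M = m⋆ d⁺ d⁻
  m = ∑ d⁺
  same : SameDegrees G₁ G₂
  same = (λ i → trans (proj₁ r₁ i) (sym (proj₁ r₂ i))) ,
         (λ i → trans (proj₂ r₁ i) (sym (proj₂ r₂ i)))

  H′-value = toℚᵘ-/-* Δ 1 (1ℚ - 1/ n) (1-1/n k)
  m⋆-value = toℚᵘ-/-* M 0 (½ - 1/ (2 ℕ.* n)) (½-1/2n k)
  m-value  = toℚᵘ-/-* m 0 (1ℚ - 1/ n) (1-1/n k)

  between : ∀ {p q P Q} → p ℚᵘ.≃ P → q ℚᵘ.≃ Q → P ℚᵘ.≤ Q → p ℚᵘ.≤ q
  between p≃P q≃Q P≤Q = ℚᵘ.≤-respˡ-≃ (ℚᵘ.≃-sym p≃P) (ℚᵘ.≤-respʳ-≃ (ℚᵘ.≃-sym q≃Q) P≤Q)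

  open ℕ.≤-Reasoning
  open +-*-Solver

  -- This and the next two are the cross-multiplied inequalities; factors `1` come from trivial
  -- denominators. Here `n = suc k`, and one `Δ` cancels from `n * Δ`.
  distance : ∀ {d w} → d ℕ.≤ w → 2 ℕ.* n ℕ.* w + Δ ℕ.≤ n ℕ.* Δ → d ℕ.* (2 ℕ.* n) ℕ.≤ Δ ℕ.* k ℕ.* 1
  distance {d} {w} d≤w bound = ℕ.+-cancelʳ-≤ Δ _ _ (begin
    d ℕ.* (2 ℕ.* n) + Δ      ≤⟨ ℕ.+-monoˡ-≤ Δ (ℕ.*-monoˡ-≤ (2 ℕ.* n) d≤w) ⟩
    w ℕ.* (2 ℕ.* n) + Δ      ≡⟨ cong (_+ Δ) (ℕ.*-comm w (2 ℕ.* n)) ⟩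
    2 ℕ.* n ℕ.* w + Δ      ≤⟨ bound ⟩
    n ℕ.* Δ                  ≡⟨ solve 2 (λ k δ → (con 1 :+ k) :* δ := δ :* k :* con 1 :+ δ) refl k Δ ⟩
    Δ ℕ.* k ℕ.* 1 + Δ      ∎)

  middle : Δ ℕ.* k ℕ.* (1 ℕ.* (2 ℕ.* n)) ℕ.≤ M ℕ.* k ℕ.* (2 ℕ.* n)
  middle = begin
    Δ ℕ.* k ℕ.* (1 ℕ.* (2 ℕ.* n))    ≡⟨ cong (Δ ℕ.* k ℕ.*_) (ℕ.*-identityˡ (2 ℕ.* n)) ⟩
    Δ ℕ.* k ℕ.* (2 ℕ.* n)
      ≤⟨ ℕ.*-monoˡ-≤ (2 ℕ.* n) (ℕ.*-monoˡ-≤ k (Δ≤m⋆ d⁺ d⁻ G₁ G₂ r₁ r₂)) ⟩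
    M ℕ.* k ℕ.* (2 ℕ.* n)            ∎

  last : M ℕ.* k ℕ.* (1 ℕ.* n) ℕ.≤ m ℕ.* k ℕ.* (1 ℕ.* (2 ℕ.* n))
  last = begin
    M ℕ.* k ℕ.* (1 ℕ.* n)
      ≤⟨ ℕ.*-monoˡ-≤ (1 ℕ.* n) (ℕ.*-monoˡ-≤ k (m⋆≤2m d⁺ d⁻ G₁ G₂ r₁ r₂)) ⟩
    2 ℕ.* m ℕ.* k ℕ.* (1 ℕ.* n)
      ≡⟨ solve 3 (λ m k n → con 2 :* m :* k :* (con 1 :* n) := m :* k :* (con 1 :* (con 2 :* n)))
           refl m k n ⟩
    m ℕ.* k ℕ.* (1 ℕ.* (2 ℕ.* n))    ∎
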